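{- For all integers $b\geq0$ and $k\geq1$, \begin{align*} T_k(q^b,q) &= \sum_{i=0}^{k-1} \frac{q^{i(2k+1)}}{(q;q)_b} \genfrac{[}{]}{0pt}{}{b}{i}_{q^2} \sum_{j=-(k-i)}^{k-i} (-q)^{j^2} +\sum_{i=0}^{b-1}\frac{(q;q)_i}{(q;q)_b}\, q^{k(2k+2i+1)} \genfrac{[}{]}{0pt}{}{b-i-1}{k-1}_{q^2}, \\ T_k(-q^b,q) &= \sum_{i=0}^{k-1} \frac{q^{i(2k+1)}}{(-q;q)_b} \genfrac{[}{]}{0pt}{}{b}{i}_{q^2} +\sum_{i=0}^{b-1}\frac{(-q;q)_i}{(-q;q)_b}\, q^{k(2k+2i+1)} \genfrac{[}{]}{0pt}{}{b-i-1}{k-1}_{q^2}, \end{align*} and for all integers $b\geq1$ and $k\geq0$, \begin{align*} T_k(q^{ -b},q) &= \sum_{i=0}^{b-1} (q^{1-b};q)_i\, (-q)^{k(k-2b+2)+2i} \genfrac{[}{]}{0pt}{}{k+i-1}{i}_{q^2}, \\ T_k(-q^{ -b},q) &= \sum_{i=0}^{k-1} (-q^{1-b};q)_b\, (-q)^{i(2k-2b-i+2)} \genfrac{[}{]}{0pt}{}{b+i-1}{i}_{q^2} \\ &\quad +(-q)^{k^2+2k-2kb} \sum_{i=0}^{b-1} (-q^{1-b};q)_i\, q^{2i} \genfrac{[}{]}{0pt}{}{k+i-1}{i}_{q^2}. \end{align*}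
   Context: The polynomials $T_k(t,q)$ in the indeterminates $t,q$ are defined by $T_0(t,q)=1$ and, for $k\ge1$, \[ T_k(t,q) = T_{k-1}(t,q) + (1+t)(-q)^{k^2} + (1-t^2) \sum_{i=1}^{k-1} (-q)^{k^2-i^2}\, T_{i-1}(t,q). \] The identities are between rational functions in $q$, obtained by substituting $t=\pm q^{\pm b}$. Notation: $(a;q)_n=\prod_{l=0}^{n-1}(1-aq^l)$ for $n\ge0$; for $0\le m\le n$, $\genfrac{[}{]}{0pt}{}{n}{m}_{q}=\frac{(q;q)_n}{(q;q)_m(q;q)_{n-m}}$, and the subscript $q^2$ means $q$ is replaced by $q^2$. Conventions: $\genfrac{[}{]}{0pt}{}{n}{m}_{q}=0$ if $m<0$ or if $m>n$ and $m\ge 1$; $\genfrac{[}{]}{0pt}{}{n}{0}_q=1$ for all $n\ge -1$. Empty sums are $0$. -}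

module Defs where

open import Algebra.Bundles.Raw using (RawRing)
import Algebra.Definitions.RawSemiring as RawSemiringDefinitions
open import Data.Fin.Base using (toℕ)
open import Data.Integer.Base as ℤ using (ℤ; 0ℤ; 1ℤ; +_; -[1+_])
import Data.Integer.Properties as ℤ
open import Data.List.Base using (List; []; _∷_; map)
open import Data.Nat.Base as ℕ using (ℕ; zero; suc)
import Data.Nat.Properties as ℕ
open import Data.Product.Base using (∃-syntax; _,_)
open import Data.Sum.Base using ([_,_]′)
open import Level using (0ℓ)
open import Relation.Binary.PropositionalEquality
  using (_≡_; _≢_; refl; sym; trans; cong; cong₂; module ≡-Reasoning)
open import Relation.Nullary using (Dec; yes; no; contradiction)

------------------------------------------------------------------------
-- The polynomial ring ℤ[q]

-- Coefficients, constant term first.  Trailing zeros are allowed, so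
-- equality of polynomials is equality of all coefficients.
Poly : Set
Poly = List ℤ

coeff : Poly → ℕ → ℤ
coeff []      _       = 0ℤ
coeff (a ∷ _) zero    = a
coeff (_ ∷ p) (suc n) = coeff p n

infix  4 _≈ₚ_
infixl 6 _+ₚ_
infixl 7 _*ₚ_
infix  8 -ₚ_

_≈ₚ_ : Poly → Poly → Set
p ≈ₚ r = ∀ n → coeff p n ≡ coeff r n

_+ₚ_ : Poly → Poly → Poly
[]      +ₚ r       = r
(a ∷ p) +ₚ []      = a ∷ p
(a ∷ p) +ₚ (b ∷ r) = a ℤ.+ b ∷ p +ₚ r

-ₚ_ : Poly → Poly
-ₚ_ = map (λ a → ℤ.- a)

_*ₚ_ : Poly → Poly → Poly
[]      *ₚ r = []
(a ∷ p) *ₚ r = map (a ℤ.*_) r +ₚ (0ℤ ∷ p *ₚ r)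

0ₚ 1ₚ X : Poly
0ₚ = []
1ₚ = 1ℤ ∷ []
X  = 0ℤ ∷ 1ℤ ∷ []

NonZeroₚ : Poly → Set
NonZeroₚ p = ∃[ n ] coeff p n ≢ 0ℤ

nonZeroₚ? : (p : Poly) → Dec (NonZeroₚ p)
nonZeroₚ? [] = no λ (_ , c≢0) → c≢0 refl
nonZeroₚ? (a ∷ p) with a ℤ.≟ 0ℤ | nonZeroₚ? p
... | no a≢0  | _               = yes (0 , a≢0)
... | yes _   | yes (n , c≢0)   = yes (suc n , c≢0)
... | yes a≡0 | no p≡0          =
  no λ { (zero , c≢0) → c≢0 a≡0 ; (suc n , c≢0) → p≡0 (n , c≢0) }

-- ℤ[q] is an integral domain; this makes products of fractions
-- well defined.

coeff-+ₚ : ∀ p r n → coeff (p +ₚ r) n ≡ coeff p n ℤ.+ coeff r n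
coeff-+ₚ []      r       n       = sym (ℤ.+-identityˡ _)
coeff-+ₚ (a ∷ p) []      n       = sym (ℤ.+-identityʳ _)
coeff-+ₚ (a ∷ p) (b ∷ r) zero    = refl
coeff-+ₚ (a ∷ p) (b ∷ r) (suc n) = coeff-+ₚ p r n

coeff-scale : ∀ a r n → coeff (map (a ℤ.*_) r) n ≡ a ℤ.* coeff r n
coeff-scale a []      n       = sym (ℤ.*-zeroʳ a)
coeff-scale a (b ∷ r) zero    = refl
coeff-scale a (b ∷ r) (suc n) = coeff-scale a r n

coeff-*ₚ : ∀ a p r n →
  coeff ((a ∷ p) *ₚ r) n ≡ a ℤ.* coeff r n ℤ.+ coeff (0ℤ ∷ p *ₚ r) n
coeff-*ₚ a p r n = trans (coeff-+ₚ (map (a ℤ.*_) r) (0ℤ ∷ p *ₚ r) n)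
                         (cong (ℤ._+ _) (coeff-scale a r n))

*ₚ-0∷ : ∀ p {b} r → b ≡ 0ℤ → ∀ n →
  coeff (p *ₚ (b ∷ r)) n ≡ coeff (0ℤ ∷ p *ₚ r) n
*ₚ-0∷ []      r b≡0 zero    = refl
*ₚ-0∷ []      r b≡0 (suc n) = refl
*ₚ-0∷ (a ∷ p) r refl zero   = cong (ℤ._+ 0ℤ) (ℤ.*-zeroʳ a)
*ₚ-0∷ (a ∷ p) {b} r b≡0 (suc n) = begin
  coeff ((a ∷ p) *ₚ (b ∷ r)) (suc n)            ≡⟨ coeff-*ₚ a p (b ∷ r) (suc n) ⟩
  a ℤ.* coeff r n ℤ.+ coeff (p *ₚ (b ∷ r)) n    ≡⟨ cong (λ c → a ℤ.* coeff r n ℤ.+ c) (*ₚ-0∷ p r b≡0 n) ⟩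
  a ℤ.* coeff r n ℤ.+ coeff (0ℤ ∷ p *ₚ r) n     ≡⟨ coeff-*ₚ a p r n ⟨
  coeff ((a ∷ p) *ₚ r) n                        ∎
  where open ≡-Reasoning

*ₚ-nonZero : ∀ p r → NonZeroₚ p → NonZeroₚ r → NonZeroₚ (p *ₚ r)
*ₚ-nonZero [] r (_ , c≢0) _ = contradiction refl c≢0
*ₚ-nonZero (a ∷ p) r p≢0 r≢0 with a ℤ.≟ 0ℤ
*ₚ-nonZero (a ∷ p) r (zero , a≢0) r≢0 | yes a≡0 = contradiction a≡0 a≢0
*ₚ-nonZero (a ∷ p) r (suc n , c≢0) r≢0 | yes refl
  with m , d≢0 ← *ₚ-nonZero p r (n , c≢0) r≢0
  = suc m , λ e → d≢0 (trans (sym (trans (coeff-*ₚ 0ℤ p r (suc m)) (ℤ.+-identityˡ _))) e)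
*ₚ-nonZero (a ∷ p) r _ r≢0 | no a≢0 = go r r≢0
  where
  go : ∀ r → NonZeroₚ r → NonZeroₚ ((a ∷ p) *ₚ r)
  go [] (_ , c≢0) = contradiction refl c≢0
  go (b ∷ r) r≢0 with b ℤ.≟ 0ℤ
  go (b ∷ r) r≢0 | no b≢0 =
    0 , λ e → [ a≢0 , b≢0 ]′ (ℤ.i*j≡0⇒i≡0∨j≡0 a (trans (sym (ℤ.+-identityʳ _)) e))
  go (b ∷ r) (zero , c≢0) | yes b≡0 = contradiction b≡0 c≢0
  go (b ∷ r) (suc n , c≢0) | yes b≡0
    with m , d≢0 ← go r (n , c≢0)
    = suc m , λ e → d≢0 (trans (sym (*ₚ-0∷ (a ∷ p) r b≡0 (suc m))) e)

------------------------------------------------------------------------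
-- The field of rational functions ℚ(q), as the fraction field of ℤ[q]

record RatFun : Set where
  constructor mkRatFun
  field
    num   : Poly
    den   : Poly
    den≢0 : NonZeroₚ den
open RatFun

fromPoly : Poly → RatFun
fromPoly p = mkRatFun p 1ₚ (0 , λ ())

ratFunRawRing : RawRing 0ℓ 0ℓ
ratFunRawRing = record
  { Carrier = RatFun
  ; _≈_     = λ f g → num f *ₚ den g ≈ₚ num g *ₚ den f
  ; _+_     = λ f g → mkRatFun (num f *ₚ den g +ₚ num g *ₚ den f) (den f *ₚ den g)
                               (*ₚ-nonZero (den f) (den g) (den≢0 f) (den≢0 g))
  ; _*_     = λ f g → mkRatFun (num f *ₚ num g) (den f *ₚ den g)
                               (*ₚ-nonZero (den f) (den g) (den≢0 f) (den≢0 g))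
  ; -_      = λ f → mkRatFun (-ₚ num f) (den f) (den≢0 f)
  ; 0#      = fromPoly 0ₚ
  ; 1#      = fromPoly 1ₚ
  }

q : RatFun
q = fromPoly X

-- Total, with 0 ⁻¹ = 0.
infix 9 _⁻¹
_⁻¹ : RatFun → RatFun
f ⁻¹ with nonZeroₚ? (num f)
... | yes num≢0 = mkRatFun (den f) (num f) num≢0
... | no  _     = fromPoly 0ₚ

------------------------------------------------------------------------
-- Notions that only need ring operations

module RingNotions {c ℓ} (R : RawRing c ℓ) where
  open RawRing R
  open RawSemiringDefinitions rawSemiring public using (_^_; sum; product)

  infixl 6 _-_
  _-_ : Carrier → Carrier → Carrier
  x - y = x + (- y)

  infixl 10 ∑<
  ∑< : ℕ → (ℕ → Carrier) → Carrier
  ∑< n f = sum {n} λ i → f (toℕ i)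

  syntax ∑< n (λ i → e) = ∑[ i < n ] e

  -- The sum of f j over all integers j with -n ≤ j ≤ n.
  infixl 10 ∑±
  ∑± : ℕ → (ℤ → Carrier) → Carrier
  ∑± n f = ∑[ l < suc (2 ℕ.* n) ] f (l ℤ.⊖ n)

  syntax ∑± n (λ j → e) = ∑[ j ∈± n ] e

  -- (a ; x)ₙ
  ⟨_⨾_⟩ : Carrier → Carrier → ℕ → Carrier
  ⟨ a ⨾ x ⟩ n = product {n} λ l → 1# - a * x ^ toℕ l

  -- T k t q is the value of the polynomial T_k at elements t and q of R;
  -- T_k itself is the case of R = ℤ[t,q] with t and q the indeterminates.
  -- In Tsum n m the index i of the defining sum runs from 1 to m (where
  -- m < n, so that ∸ is subtraction) and n is the k in the exponent k² - i².
  T    : ℕ → Carrier → Carrier → Carrier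
  Tsum : ℕ → ℕ → Carrier → Carrier → Carrier

  T zero    t q = 1#
  T (suc k) t q = T k t q
                + (1# + t) * (- q) ^ (suc k ℕ.^ 2)
                + (1# - t ^ 2) * Tsum (suc k) k t q

  Tsum n zero    t q = 0#
  Tsum n (suc i) t q = Tsum n i t q
                     + (- q) ^ (n ℕ.^ 2 ℕ.∸ suc i ℕ.^ 2) * T i t q

open RawRing ratFunRawRing public using (_≈_; _+_; _*_; -_; 0#; 1#)
open RingNotions ratFunRawRing public

------------------------------------------------------------------------
-- Notions that need division

infixl 7 _/_
_/_ : RatFun → RatFun → RatFun
f / g = f * g ⁻¹

infixr 8 _^ℤ_
_^ℤ_ : RatFun → ℤ → RatFun
f ^ℤ (+ n)    = f ^ n
f ^ℤ -[1+ n ] = (f ⁻¹) ^ suc n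

-- The x-binomial coefficient [n m]ₓ, including the conventions outside
-- 0 ≤ m ≤ n: it is 0 if m < 0, or if m > n and m ≥ 1, and [n 0] = 1 for
-- n = -1.  (The value 1 for m = 0 and n < -1 is arbitrary.)
gauss : RatFun → ℤ → ℤ → RatFun
gauss x (+ n)    (+ m) with m ℕ.≤? n
... | yes _ = ⟨ x ⨾ x ⟩ n / (⟨ x ⨾ x ⟩ m * ⟨ x ⨾ x ⟩ (n ℕ.∸ m))
... | no  _ = 0#
gauss x -[1+ _ ] (+ zero)  = 1#
gauss x -[1+ _ ] (+ suc _) = 0#
gauss x _        -[1+ _ ]  = 0#

-- Taking differences in the defining sum gives the three-term recurrence
--
--   T_{k+2}(t) = (1 - q^{2k+3}) T_{k+1}(t) + t² q^{2k+3} T_k(t),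
--
-- and from it, by induction on k, a relation between t and t q:
--
--   (1 - t q) T_{k+1}(t q) = T_{k+1}(t) + t² q^{2k+3} T_k(t).
--
-- Put t = s q^{±b} with s² = 1.  Read from t to t q, the relation is a
-- recurrence in b for (s q; q)_b T_k(s q^b); read backwards, it determines
-- T_k(s q^{-b}) from T_k(s q^{1-b}) and T_{k-1}(s q^{-b}).  By Pascal's rules
-- for the q²-binomials the sums claimed satisfy the same recurrences, with the
-- numbers T_m(s) as coefficients, where T_m(1) = Σ_{|j|≤m} (-q)^{j²} and
-- T_m(-1) = 1.  For s = 1 the first of the two sums for q^{-b} has the factor
-- (q^{1-b}; q)_b = 0.

module Submission where

import Defs
open Defs using (module RingNotions)
open import Algebra.Bundles using (CommutativeRing; RawRing)
import Algebra.Properties.AbelianGroup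
import Algebra.Properties.CommutativeSemiring.Exp
import Algebra.Properties.Ring
import Algebra.Properties.Semiring.Mult.TCOptimised
import Algebra.Properties.Semiring.Sum
import Algebra.Solver.Ring
open import Algebra.Solver.Ring.AlmostCommutativeRing
  using (_-Raw-AlmostCommutative⟶_; fromCommutativeRing)
open import Algebra.Structures using (IsCommutativeRing)
open import Data.Fin.Base using (toℕ)
open import Data.Integer.Base as ℤ using (ℤ; 0ℤ; 1ℤ; +_; -[1+_])
import Data.Integer.Properties as ℤ
import Data.Integer.Tactic.RingSolver as ℤ-Solver
open import Data.List.Base using ([]; _∷_; map)
open import Data.Maybe.Base using (Maybe; just; nothing)
open import Data.Nat.Base as ℕ using (ℕ; zero; suc; z≤n; s≤s)
import Data.Nat.Properties as ℕ
import Data.Nat.Tactic.RingSolver as ℕ-Solver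
open import Data.Product.Base using (_,_)
open import Data.Sum.Base using (_⊎_; inj₁; inj₂)
open import Level using (0ℓ)
open import Relation.Binary.PropositionalEquality as ≡ using (_≡_)
import Relation.Binary.Reasoning.Setoid
open import Relation.Nullary using (yes; no; contradiction)

-- Both recurrences live on the grid of pairs (b, k), and each claimed sum adds up weighted paths
-- that start on one edge of it. For s q^b a path steps from (b, k) to (b+1, k) with weight 1, or to
-- (b+1, k+1) with weight q^(2k+3+2b). The first sum collects the paths starting at (0, k-i) with
-- value T_(k-i)(s). The second collects those leaving the edge k = 0 at (i, 0), where the value is
-- (s q; q)_i; the step off the edge is forced, whence [b-i-1 k-1]. For s q^(-b) the steps raise b
-- or k separately, the same two edges give the two sums, and the forced first step explains
-- [b+i-1 i] and [k+i-1 i].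
--
-- The obstacle is division. The recurrences are therefore solved over an arbitrary commutative
-- ring: q-binomials are defined by Pascal's rule, the denominator (s q; q)_b stays on the left-hand
-- side, and the inverse of q is an element p with q p = 1. The field of rational functions enters
-- only at the end, where the denominators are invertible because they take the value 1 at q = 0.

-- A ring solver with integer coefficients over any commutative ring.

-- The coefficients of the ring solver need a decidable equality for x - x to
-- normalise to 0, hence ℤ and not the carrier of R.
module IntegerSolver {c ℓ} (R : CommutativeRing c ℓ) where
  open CommutativeRing R
  open Algebra.Properties.AbelianGroup +-abelianGroup using (⁻¹-∙-comm; ε⁻¹≈ε; ⁻¹-involutive)
  open Algebra.Properties.Ring ring using (-‿distribˡ-*; -‿distribʳ-*)
  open Algebra.Properties.Semiring.Mult.TCOptimised semiring
    using (_×_; 1+×; ×-homo-+; ×1-homo-*)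
  open Relation.Binary.Reasoning.Setoid setoid

  fromℤ : ℤ → Carrier
  fromℤ (+ n)    = n × 1#
  fromℤ -[1+ n ] = - (suc n × 1#)

  fromℤ-neg : ∀ i → fromℤ (ℤ.- i) ≈ - fromℤ i
  fromℤ-neg (+ zero)  = sym ε⁻¹≈ε
  fromℤ-neg (+ suc n) = refl
  fromℤ-neg -[1+ n ]  = sym (⁻¹-involutive _)

  fromℤ-⊖ : ∀ m n → fromℤ (m ℤ.⊖ n) ≈ m × 1# - n × 1#
  fromℤ-⊖ m zero = begin
    fromℤ (m ℤ.⊖ 0)  ≡⟨ ≡.cong fromℤ (ℤ.⊖-≥ {m} ℕ.z≤n) ⟩
    m × 1#           ≈⟨ +-identityʳ _ ⟨
    m × 1# + 0#      ≈⟨ +-congˡ ε⁻¹≈ε ⟨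
    m × 1# - 0#      ∎
  fromℤ-⊖ zero (suc n) = sym (+-identityˡ _)
  fromℤ-⊖ (suc m) (suc n) = begin
    fromℤ (suc m ℤ.⊖ suc n)                ≡⟨ ≡.cong fromℤ (ℤ.[1+m]⊖[1+n]≡m⊖n m n) ⟩
    fromℤ (m ℤ.⊖ n)                        ≈⟨ fromℤ-⊖ m n ⟩
    m × 1# - n × 1#                        ≈⟨ +-congʳ (+-identityʳ (m × 1#)) ⟨
    m × 1# + 0# - n × 1#                   ≈⟨ +-congʳ (+-congˡ (-‿inverseʳ 1#)) ⟨
    m × 1# + (1# - 1#) - n × 1#            ≈⟨ +-congʳ (+-assoc _ _ _) ⟨
    m × 1# + 1# - 1# - n × 1#              ≈⟨ +-assoc _ _ _ ⟩
    m × 1# + 1# + (- 1# - n × 1#)          ≈⟨ +-cong (+-comm _ _) (⁻¹-∙-comm _ _) ⟩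
    1# + m × 1# - (1# + n × 1#)            ≈⟨ +-cong (1+× m 1#) (-‿cong (1+× n 1#)) ⟨
    suc m × 1# - suc n × 1#                ∎

  fromℤ-+ : ∀ i j → fromℤ (i ℤ.+ j) ≈ fromℤ i + fromℤ j
  fromℤ-+ (+ m)    (+ n)    = ×-homo-+ 1# m n
  fromℤ-+ (+ m)    -[1+ n ] = fromℤ-⊖ m (suc n)
  fromℤ-+ -[1+ m ] (+ n)    = trans (fromℤ-⊖ n (suc m)) (+-comm _ _)
  fromℤ-+ -[1+ m ] -[1+ n ] = begin
    - (suc (suc (m ℕ.+ n)) × 1#)       ≡⟨ ≡.cong (λ k → - (suc k × 1#)) (ℕ.+-suc m n) ⟨
    - ((suc m ℕ.+ suc n) × 1#)         ≈⟨ -‿cong (×-homo-+ 1# (suc m) (suc n)) ⟩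
    - (suc m × 1# + suc n × 1#)        ≈⟨ ⁻¹-∙-comm _ _ ⟨
    - (suc m × 1#) - suc n × 1#        ∎

  fromℤ-*-pos : ∀ m j → fromℤ (+ m ℤ.* j) ≈ m × 1# * fromℤ j
  fromℤ-*-pos m (+ n) = begin
    fromℤ (+ m ℤ.* + n)  ≡⟨ ≡.cong fromℤ (ℤ.pos-* m n) ⟨
    (m ℕ.* n) × 1#       ≈⟨ ×1-homo-* m n ⟩
    m × 1# * n × 1#      ∎
  fromℤ-*-pos m -[1+ n ] = begin
    fromℤ (+ m ℤ.* -[1+ n ])         ≡⟨ ≡.cong fromℤ (ℤ.neg-distribʳ-* (+ m) (+ suc n)) ⟨
    fromℤ (ℤ.- (+ m ℤ.* + suc n))    ≈⟨ fromℤ-neg (+ m ℤ.* + suc n) ⟩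
    - fromℤ (+ m ℤ.* + suc n)        ≡⟨ ≡.cong (λ i → - fromℤ i) (ℤ.pos-* m (suc n)) ⟨
    - ((m ℕ.* suc n) × 1#)           ≈⟨ -‿cong (×1-homo-* m (suc n)) ⟩
    - (m × 1# * suc n × 1#)          ≈⟨ -‿distribʳ-* _ _ ⟩
    m × 1# * - (suc n × 1#)          ∎

  fromℤ-* : ∀ i j → fromℤ (i ℤ.* j) ≈ fromℤ i * fromℤ j
  fromℤ-* (+ m)    j = fromℤ-*-pos m j
  fromℤ-* -[1+ m ] j = begin
    fromℤ (-[1+ m ] ℤ.* j)           ≡⟨ ≡.cong fromℤ (ℤ.neg-distribˡ-* (+ suc m) j) ⟨
    fromℤ (ℤ.- (+ suc m ℤ.* j))      ≈⟨ fromℤ-neg (+ suc m ℤ.* j) ⟩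
    - fromℤ (+ suc m ℤ.* j)          ≈⟨ -‿cong (fromℤ-*-pos (suc m) j) ⟩
    - (suc m × 1# * fromℤ j)         ≈⟨ -‿distribˡ-* _ _ ⟩
    - (suc m × 1#) * fromℤ j         ∎

  fromℤ-homomorphism : ℤ.+-*-rawRing -Raw-AlmostCommutative⟶ fromCommutativeRing R
  fromℤ-homomorphism = record
    { ⟦_⟧    = fromℤ
    ; +-homo = fromℤ-+
    ; *-homo = fromℤ-*
    ; -‿homo = fromℤ-neg
    ; 0-homo = refl
    ; 1-homo = refl
    }

  fromℤ-≟ : ∀ i j → Maybe (fromℤ i ≈ fromℤ j)
  fromℤ-≟ i j with i ℤ.≟ j
  ... | yes ≡.refl = just refl
  ... | no _       = nothing

  open Algebra.Solver.Ring ℤ.+-*-rawRing (fromCommutativeRing R) fromℤ-homomorphism fromℤ-≟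
    public using (solve; _:=_; _:+_; _:*_; _:-_; :-_; _:^_; con)

-- Identities between exponents of q.

module NatExponents where
  open import Data.Nat.Base using (_+_; _*_)

  square : ∀ n → suc n * (suc n * 1) ≡ suc (2 * n) + n * (n * 1)
  square = ℕ-Solver.solve-∀

  -- The remainder shared by `head-split` and `head-merge` is the `r` of `binomial-mirror-q²`:
  -- Pascal's rule trades the factor q^(2i) for q^(2b) and leaves the rest alone. `tail-split` and
  -- `tail-merge` form such a pair for the second sum.
  head-split : ∀ k i → suc i * (2 * suc k + 1) ≡ 2 * i + (i * (2 * k + 1) + 2 * k + 3)
  head-split = ℕ-Solver.solve-∀

  head-merge : ∀ b k i →
    2 * k + 3 + 2 * b + i * (2 * k + 1) ≡ 2 * b + (i * (2 * k + 1) + 2 * k + 3)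
  head-merge = ℕ-Solver.solve-∀

  tail-one : ∀ b → 1 * (2 + 2 * b + 1) ≡ 3 + 2 * b
  tail-one = ℕ-Solver.solve-∀

  tail-split : ∀ k i → suc (suc k) * (2 * suc (suc k) + 2 * i + 1)
    ≡ 2 * k + (2 * k + 2 * i + 7 + suc k * (2 * suc k + 2 * i + 1))
  tail-split = ℕ-Solver.solve-∀

  tail-merge : ∀ k i n e →
    2 * suc k + 3 + 2 * suc (i + n) + e ≡ 2 * n + (2 * k + 2 * i + 7 + e)
  tail-merge = ℕ-Solver.solve-∀

  descent : ∀ b k → 2 * k + 3 + 2 * b ≡ suc (2 * suc k) + b * 2
  descent = ℕ-Solver.solve-∀

  even : ∀ i k → 2 * suc i + 2 * k ≡ 2 * suc k + 2 * i
  even = ℕ-Solver.solve-∀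

module IntExponents where
  open import Data.Integer.Base using (_+_; _-_; _*_; -_)

  head-b : ∀ b k i → (1ℤ + i) * (+ 2 * (1ℤ + k) - + 2 * b - (1ℤ + i) + + 2)
    ≡ (1ℤ + i) * (+ 2 * (1ℤ + k) - + 2 * (1ℤ + b) - (1ℤ + i) + + 2) + + 2 * (1ℤ + i)
  head-b = ℤ-Solver.solve-∀

  head-k : ∀ b k i → (1ℤ + i) * (+ 2 * (1ℤ + k) - + 2 * b - (1ℤ + i) + + 2)
    ≡ (+ 2 * k + + 3 - + 2 * b) + i * (+ 2 * k - + 2 * b - i + + 2)
  head-k = ℤ-Solver.solve-∀

  tail-b : ∀ b k → k * (k - + 2 * b + + 2) ≡ k * (k - + 2 * (1ℤ + b) + + 2) + + 2 * k
  tail-b = ℤ-Solver.solve-∀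

  tail-k : ∀ b k → (1ℤ + k) * ((1ℤ + k) - + 2 * b + + 2)
    ≡ (+ 2 * k + + 3 - + 2 * b) + k * (k - + 2 * b + + 2)
  tail-k = ℤ-Solver.solve-∀

  tail-expand : ∀ k b → k * (k - + 2 * b + + 2) ≡ k * k + + 2 * k - + 2 * k * b
  tail-expand = ℤ-Solver.solve-∀

  descent : ∀ b k → + 2 * k + + 3 - + 2 * b ≡ 1ℤ + - (+ 2 * b) + + 2 * (1ℤ + k)
  descent = ℤ-Solver.solve-∀

  index : ∀ i n → 1ℤ + (i + n) - i - 1ℤ ≡ n
  index = ℤ-Solver.solve-∀

-- Sums, powers and Pochhammer symbols.

module RingLemmas {c ℓ} (R : CommutativeRing c ℓ) where
  open CommutativeRing R hiding (_-_; zero)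
  open RingNotions rawRing
  open IntegerSolver R
  open Algebra.Properties.CommutativeSemiring.Exp commutativeSemiring
    using (^-congˡ; ^-homo-*; ^-assocʳ)
  open Algebra.Properties.Semiring.Sum semiring
    using (sum-replicate-zero; ∑-distrib-+; *-distribˡ-sum)
  open Relation.Binary.Reasoning.Setoid setoid

  ∑-cong< : ∀ n {f g} → (∀ i → i ℕ.< n → f i ≈ g i) → ∑< n f ≈ ∑< n g
  ∑-cong< zero    f≈g = refl
  ∑-cong< (suc n) f≈g =
    +-cong (f≈g 0 ℕ.z<s) (∑-cong< n λ i i<n → f≈g (suc i) (s≤s i<n))

  ∑-cong : ∀ n {f g} → (∀ i → f i ≈ g i) → ∑< n f ≈ ∑< n g
  ∑-cong n f≈g = ∑-cong< n λ i _ → f≈g i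

  ∑-zero : ∀ n → ∑< n (λ _ → 0#) ≈ 0#
  ∑-zero n = sum-replicate-zero n

  ∑-+ : ∀ n f g → ∑< n (λ i → f i + g i) ≈ ∑< n f + ∑< n g
  ∑-+ n f g = ∑-distrib-+ {n} (λ i → f (toℕ i)) (λ i → g (toℕ i))

  ∑-*ˡ : ∀ n a f → ∑< n (λ i → a * f i) ≈ a * ∑< n f
  ∑-*ˡ n a f = sym (*-distribˡ-sum {n} a (λ i → f (toℕ i)))

  ∑-last : ∀ n f → ∑< (suc n) f ≈ ∑< n f + f n
  ∑-last zero    f = trans (+-identityʳ _) (sym (+-identityˡ _))
  ∑-last (suc n) f = trans (+-congˡ (∑-last n (λ i → f (suc i)))) (sym (+-assoc _ _ _))

  ^-≡ : ∀ x {m n} → m ≡ n → x ^ m ≈ x ^ n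
  ^-≡ x ≡.refl = refl

  ^-split : ∀ x {e} m n → e ≡ m ℕ.+ n → x ^ e ≈ x ^ m * x ^ n
  ^-split x m n ≡.refl = ^-homo-* x m n

  ^-inverse : ∀ {x y} → x * y ≈ 1# → ∀ n → x ^ n * y ^ n ≈ 1#
  ^-inverse xy≈1 zero = *-identityˡ 1#
  ^-inverse {x} {y} xy≈1 (suc n) = begin
    x * x ^ n * (y * y ^ n)
      ≈⟨ solve 4 (λ x y z w → x :* z :* (y :* w) := x :* y :* (z :* w)) refl _ _ _ _ ⟩
    x * y * (x ^ n * y ^ n)
      ≈⟨ *-cong xy≈1 (^-inverse xy≈1 n) ⟩
    1# * 1#
      ≈⟨ *-identityˡ 1# ⟩
    1# ∎

  neg-^-even : ∀ x n → (- x) ^ (2 ℕ.* n) ≈ x ^ (2 ℕ.* n)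
  neg-^-even x n = begin
    (- x) ^ (2 ℕ.* n)  ≈⟨ ^-assocʳ (- x) 2 n ⟨
    ((- x) ^ 2) ^ n    ≈⟨ ^-congˡ n (solve 1 (λ x → (:- x) :^ 2 := x :^ 2) refl x) ⟩
    (x ^ 2) ^ n        ≈⟨ ^-assocʳ x 2 n ⟩
    x ^ (2 ℕ.* n)      ∎

  neg-^-odd : ∀ x n → (- x) ^ suc (2 ℕ.* n) ≈ - (x ^ suc (2 ℕ.* n))
  neg-^-odd x n = trans (*-congˡ (neg-^-even x n))
    (solve 2 (λ x y → (:- x) :* y := :- (x :* y)) refl x (x ^ (2 ℕ.* n)))

  pochhammer-first : ∀ a x n → ⟨ a ⨾ x ⟩ (suc n) ≈ (1# - a) * ⟨ a * x ⨾ x ⟩ n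
  pochhammer-first a x n = *-cong (+-congˡ (-‿cong (*-identityʳ a))) (tail n (λ l → l))
    where
    -- Removing the first factor of the product shifts the index, so the induction needs exponents
    -- given by an arbitrary function `e`.
    tail : ∀ n e → (product {n} λ l → 1# - a * x ^ suc (e (toℕ l)))
                 ≈ (product {n} λ l → 1# - a * x * x ^ e (toℕ l))
    tail zero    e = refl
    tail (suc n) e =
      *-cong (+-congˡ (-‿cong (sym (*-assoc a x _)))) (tail n (λ l → e (suc l)))

  pochhammer-last : ∀ a x n → ⟨ a ⨾ x ⟩ (suc n) ≈ ⟨ a ⨾ x ⟩ n * (1# - a * x ^ n)
  pochhammer-last a x n = go n (λ l → 1# - a * x ^ l)
    where
    go : ∀ n f → (product {suc n} λ l → f (toℕ l)) ≈ (product {n} λ l → f (toℕ l)) * f n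
    go zero    f = trans (*-identityʳ _) (sym (*-identityˡ _))
    go (suc n) f = trans (*-congˡ (go n (λ l → f (suc l)))) (sym (*-assoc _ _ _))

  pochhammer-cong : ∀ {a b} x n → a ≈ b → ⟨ a ⨾ x ⟩ n ≈ ⟨ b ⨾ x ⟩ n
  pochhammer-cong {a} {b} x n a≈b = go n (λ l → l)
    where
    go : ∀ n e → (product {n} λ l → 1# - a * x ^ e (toℕ l))
               ≈ (product {n} λ l → 1# - b * x ^ e (toℕ l))
    go zero    e = refl
    go (suc n) e = *-cong (+-congˡ (-‿cong (*-congʳ a≈b))) (go n (λ l → e (suc l)))

  -- Recurrences for T_k.

  T-cong    : ∀ k {t u} q → t ≈ u → T k t q ≈ T k u q
  Tsum-cong : ∀ n k {t u} q → t ≈ u → Tsum n k t q ≈ Tsum n k u q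
  T-cong zero    q t≈u = refl
  T-cong (suc k) q t≈u =
    +-cong (+-cong (T-cong k q t≈u) (*-congʳ (+-congˡ t≈u)))
           (*-cong (+-congˡ (-‿cong (^-congˡ 2 t≈u))) (Tsum-cong (suc k) k q t≈u))
  Tsum-cong n zero    q t≈u = refl
  Tsum-cong n (suc k) q t≈u = +-cong (Tsum-cong n k q t≈u) (*-congˡ (T-cong k q t≈u))

  suc^2 : ∀ n → suc n ℕ.^ 2 ≡ suc (2 ℕ.* n) ℕ.+ n ℕ.^ 2
  suc^2 = NatExponents.square

  suc^2∸ : ∀ {n i} → i ℕ.≤ n →
    suc n ℕ.^ 2 ℕ.∸ i ℕ.^ 2 ≡ suc (2 ℕ.* n) ℕ.+ (n ℕ.^ 2 ℕ.∸ i ℕ.^ 2)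
  suc^2∸ {n} {i} i≤n = ≡.trans (≡.cong (ℕ._∸ i ℕ.^ 2) (suc^2 n))
    (ℕ.+-∸-assoc (suc (2 ℕ.* n)) (ℕ.^-monoˡ-≤ 2 i≤n))

  -- Every exponent (n+1)² - i² exceeds n² - i² by the same odd number 2n+1, so the whole sum is
  -- scaled. The bound `k ≤ n` keeps the truncated subtractions exact.
  Tsum-suc : ∀ n k t q → k ℕ.≤ n → Tsum (suc n) k t q ≈ - (q ^ suc (2 ℕ.* n)) * Tsum n k t q
  Tsum-suc n zero    t q k≤n = sym (zeroʳ _)
  Tsum-suc n (suc k) t q k<n = begin
    Tsum (suc n) k t q + (- q) ^ (suc n ℕ.^ 2 ℕ.∸ suc k ℕ.^ 2) * T k t q
      ≈⟨ +-cong (Tsum-suc n k t q (ℕ.<⇒≤ k<n))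
                (*-congʳ (trans (^-split (- q) (suc (2 ℕ.* n)) _ (suc^2∸ k<n))
                                (*-congʳ (neg-^-odd q n)))) ⟩
    - (q ^ suc (2 ℕ.* n)) * Tsum n k t q
      + - (q ^ suc (2 ℕ.* n)) * (- q) ^ (n ℕ.^ 2 ℕ.∸ suc k ℕ.^ 2) * T k t q
      ≈⟨ solve 4 (λ x s y z → x :* s :+ x :* y :* z := x :* (s :+ y :* z)) refl _ _ _ _ ⟩
    - (q ^ suc (2 ℕ.* n)) * (Tsum n k t q + (- q) ^ (n ℕ.^ 2 ℕ.∸ suc k ℕ.^ 2) * T k t q) ∎

  -- The increment T_(k+2) - T_(k+1) is -x times the increment T_(k+1) - T_k, apart from the new
  -- summand i = k+1, which adds -x (1 - t²) T_k.
  T-recurrence : ∀ k t q → let x = q ^ suc (2 ℕ.* suc k) in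
    T (suc (suc k)) t q ≈ (1# - x) * T (suc k) t q + t ^ 2 * x * T k t q
  T-recurrence k t q = begin
    T n t q + (1# + t) * (- q) ^ (suc n ℕ.^ 2)
      + (1# - t ^ 2) * (Tsum (suc n) k t q + (- q) ^ (suc n ℕ.^ 2 ℕ.∸ n ℕ.^ 2) * T k t q)
      ≈⟨ +-cong (+-congˡ (*-congˡ Q^))
                (*-congˡ (+-cong (Tsum-suc n k t q (ℕ.n≤1+n k)) (*-congʳ Q^∸))) ⟩
    T n t q + (1# + t) * (- x * (- q) ^ (n ℕ.^ 2))
      + (1# - t ^ 2) * (- x * Tsum n k t q + - x * T k t q)
      ≈⟨ solve 5 (λ t x y a s →
            y :+ (con 1ℤ :+ t) :* a :+ (con 1ℤ :- t :^ 2) :* s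
              :+ (con 1ℤ :+ t) :* (:- x :* a) :+ (con 1ℤ :- t :^ 2) :* (:- x :* s :+ :- x :* y)
            := (con 1ℤ :- x) :* (y :+ (con 1ℤ :+ t) :* a :+ (con 1ℤ :- t :^ 2) :* s) :+ t :^ 2 :* x :* y)
           refl t x (T k t q) ((- q) ^ (n ℕ.^ 2)) (Tsum n k t q) ⟩
    (1# - x) * T n t q + t ^ 2 * x * T k t q ∎
    where
    n = suc k
    x = q ^ suc (2 ℕ.* n)
    Q^ : (- q) ^ (suc n ℕ.^ 2) ≈ - x * (- q) ^ (n ℕ.^ 2)
    Q^ = trans (^-split (- q) (suc (2 ℕ.* n)) _ (suc^2 n)) (*-congʳ (neg-^-odd q n))
    Q^∸ : (- q) ^ (suc n ℕ.^ 2 ℕ.∸ n ℕ.^ 2) ≈ - x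
    Q^∸ = trans
      (^-≡ (- q) (≡.trans (≡.cong (ℕ._∸ n ℕ.^ 2) (suc^2 n)) (ℕ.m+n∸n≡m (suc (2 ℕ.* n)) (n ℕ.^ 2))))
      (neg-^-odd q n)

  -- Both sides satisfy the three-term recurrence of T k (t * q) q.
  T-shift : ∀ k t q →
    (1# - t * q) * T k (t * q) q ≈ T (suc k) t q + q ^ suc (2 ℕ.* k) * T k t q
  T-shift zero t q = solve 2 (λ t q →
    (con 1ℤ :- t :* q) :* con 1ℤ
      := con 1ℤ :+ (con 1ℤ :+ t) :* (:- q) :^ 1 :+ (con 1ℤ :- t :^ 2) :* con 0ℤ :+ q :^ 1 :* con 1ℤ)
    refl t q
  T-shift (suc zero) t q = begin
    (1# - t * q) * T 1 (t * q) q
      ≈⟨ solve 2 (λ t q →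
           (con 1ℤ :- t :* q)
             :* (con 1ℤ :+ (con 1ℤ :+ t :* q) :* (:- q) :^ 1 :+ (con 1ℤ :- (t :* q) :^ 2) :* con 0ℤ)
           := (con 1ℤ :- q :^ 3) :* (con 1ℤ :+ (con 1ℤ :+ t) :* (:- q) :^ 1 :+ (con 1ℤ :- t :^ 2) :* con 0ℤ)
             :+ t :^ 2 :* q :^ 3 :* con 1ℤ
             :+ q :^ 3 :* (con 1ℤ :+ (con 1ℤ :+ t) :* (:- q) :^ 1 :+ (con 1ℤ :- t :^ 2) :* con 0ℤ))
           refl t q ⟩
    (1# - q ^ 3) * T 1 t q + t ^ 2 * q ^ 3 * T 0 t q + q ^ 3 * T 1 t q
      ≈⟨ +-congʳ (T-recurrence 0 t q) ⟨
    T 2 t q + q ^ 3 * T 1 t q ∎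
  T-shift (suc (suc k)) t q = begin
    (1# - t * q) * T (suc (suc k)) (t * q) q
      ≈⟨ *-congˡ (T-recurrence k (t * q) q) ⟩
    (1# - t * q) * ((1# - x) * T (suc k) (t * q) q + (t * q) ^ 2 * x * T k (t * q) q)
      ≈⟨ solve 5 (λ t q x a b →
           (con 1ℤ :- t :* q) :* ((con 1ℤ :- x) :* a :+ (t :* q) :^ 2 :* x :* b)
           := (con 1ℤ :- x) :* ((con 1ℤ :- t :* q) :* a)
             :+ t :^ 2 :* (q :^ 2 :* x) :* ((con 1ℤ :- t :* q) :* b)) refl _ _ _ _ _ ⟩
    (1# - x) * ((1# - t * q) * T (suc k) (t * q) q)
      + t ^ 2 * (q ^ 2 * x) * ((1# - t * q) * T k (t * q) q)
      ≈⟨ +-cong (*-congˡ (trans (T-shift (suc k) t q) (+-congʳ (T-recurrence k t q))))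
                (*-congˡ (T-shift k t q)) ⟩
    (1# - x) * ((1# - x) * T (suc k) t q + t ^ 2 * x * T k t q + x * T (suc k) t q)
      + t ^ 2 * (q ^ 2 * x) * (T (suc k) t q + y * T k t q)
      -- The q² that comes from (t q)² turns `y` into `x`. Everything is then expressed by
      -- T_(k+1)(t), T_k(t), q² and `x`, and what remains is a polynomial identity.
      ≈⟨ +-congˡ (solve 6 (λ t q x y a b →
           t :^ 2 :* (q :^ 2 :* x) :* (a :+ y :* b)
           := t :^ 2 :* x :* (q :^ 2 :* a :+ q :^ 2 :* y :* b)) refl _ _ _ _ _ _) ⟩
    (1# - x) * ((1# - x) * T (suc k) t q + t ^ 2 * x * T k t q + x * T (suc k) t q)
      + t ^ 2 * x * (q ^ 2 * T (suc k) t q + q ^ 2 * y * T k t q)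
      ≈⟨ +-congˡ (*-congˡ (+-congˡ (*-congʳ (q²* k)))) ⟩
    (1# - x) * ((1# - x) * T (suc k) t q + t ^ 2 * x * T k t q + x * T (suc k) t q)
      + t ^ 2 * x * (q ^ 2 * T (suc k) t q + x * T k t q)
      ≈⟨ solve 5 (λ t q x a b →
           (con 1ℤ :- x) :* ((con 1ℤ :- x) :* a :+ t :^ 2 :* x :* b :+ x :* a)
             :+ t :^ 2 :* x :* (q :^ 2 :* a :+ x :* b)
           := (con 1ℤ :- q :^ 2 :* x) :* ((con 1ℤ :- x) :* a :+ t :^ 2 :* x :* b)
             :+ t :^ 2 :* (q :^ 2 :* x) :* a :+ q :^ 2 :* x :* ((con 1ℤ :- x) :* a :+ t :^ 2 :* x :* b))
           refl t q x (T (suc k) t q) (T k t q) ⟩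
    (1# - q ^ 2 * x) * ((1# - x) * T (suc k) t q + t ^ 2 * x * T k t q)
      + t ^ 2 * (q ^ 2 * x) * T (suc k) t q
      + q ^ 2 * x * ((1# - x) * T (suc k) t q + t ^ 2 * x * T k t q)
      ≈⟨ +-cong (+-cong (*-cong (+-congˡ (-‿cong (q²* (suc k)))) (sym (T-recurrence k t q)))
                        (*-congʳ (*-congˡ (q²* (suc k)))))
                (*-cong (q²* (suc k)) (sym (T-recurrence k t q))) ⟩
    (1# - x′) * T (suc (suc k)) t q + t ^ 2 * x′ * T (suc k) t q + x′ * T (suc (suc k)) t q
      ≈⟨ +-congʳ (T-recurrence (suc k) t q) ⟨
    T (suc (suc (suc k))) t q + x′ * T (suc (suc k)) t q ∎
    where
    x x′ y : Carrier
    x = q ^ suc (2 ℕ.* suc k)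
    x′ = q ^ suc (2 ℕ.* suc (suc k))
    y = q ^ suc (2 ℕ.* k)
    q²* : ∀ k → q ^ 2 * q ^ suc (2 ℕ.* k) ≈ q ^ suc (2 ℕ.* suc k)
    q²* k = sym (^-split q 2 (suc (2 ℕ.* k)) (≡.cong suc (ℕ.*-suc 2 k)))

  -- `T-shift` relates t q to the higher index k+2. Eliminating T_(k+2) leaves the indices k+1 and k
  -- only, which is what lets an induction over b and k close.
  T-descent : ∀ k t q →
    (1# - t * q) * T (suc k) (t * q) q
      ≈ T (suc k) t q + t ^ 2 * q ^ suc (2 ℕ.* suc k) * T k t q
  T-descent k t q = begin
    (1# - t * q) * T (suc k) (t * q) q
      ≈⟨ T-shift (suc k) t q ⟩
    T (suc (suc k)) t q + x * T (suc k) t q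
      ≈⟨ +-congʳ (T-recurrence k t q) ⟩
    (1# - x) * T (suc k) t q + t ^ 2 * x * T k t q + x * T (suc k) t q
      ≈⟨ solve 4 (λ t x a b → (con 1ℤ :- x) :* a :+ t :^ 2 :* x :* b :+ x :* a
                           := a :+ t :^ 2 :* x :* b) refl _ _ _ _ ⟩
    T (suc k) t q + t ^ 2 * x * T k t q ∎
    where x = q ^ suc (2 ℕ.* suc k)

-- Gaussian binomials without division.

module GaussianBinomials {c ℓ} (R : CommutativeRing c ℓ) where
  open CommutativeRing R hiding (_-_; zero)
  open RingNotions rawRing
  open IntegerSolver R
  open RingLemmas R
  open Algebra.Properties.CommutativeSemiring.Exp commutativeSemiring
    using (^-homo-*)
  open Relation.Binary.Reasoning.Setoid setoid

  -- Pascal's rule serves as the definition because it makes sense in every commutative ring;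
  -- `binomial-pochhammer` ties it to the quotient of q-factorials.
  binomial : Carrier → ℕ → ℕ → Carrier
  binomial x n       zero    = 1#
  binomial x zero    (suc m) = 0#
  binomial x (suc n) (suc m) = binomial x n m + x ^ suc m * binomial x n (suc m)

  binomial-zero : ∀ x {n m} → n ℕ.< m → binomial x n m ≈ 0#
  binomial-zero x {zero}  {suc m} _ = refl
  binomial-zero x {suc n} {suc m} (s≤s n<m) = begin
    binomial x n m + x ^ suc m * binomial x n (suc m)
      ≈⟨ +-cong (binomial-zero x n<m) (*-congˡ (binomial-zero x (ℕ.m<n⇒m<1+n n<m))) ⟩
    0# + x ^ suc m * 0#
      ≈⟨ solve 1 (λ y → con 0ℤ :+ y :* con 0ℤ := con 0ℤ) refl _ ⟩
    0# ∎

  -- The mirror image of the recurrence that defines binomial, multiplied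
  -- by x ^ m because its coefficient is x ^ (n - m).
  binomial-mirror : ∀ x n m →
    x ^ m * binomial x (suc n) (suc m) ≈ x ^ n * binomial x n m + x ^ m * binomial x n (suc m)
  binomial-mirror x zero zero =
    solve 1 (λ x → con 1ℤ :* (con 1ℤ :+ x :^ 1 :* con 0ℤ)
                := con 1ℤ :* con 1ℤ :+ con 1ℤ :* con 0ℤ) refl x
  binomial-mirror x zero (suc m) =
    solve 2 (λ y z → y :* (con 0ℤ :+ z :* con 0ℤ)
                := con 1ℤ :* con 0ℤ :+ y :* con 0ℤ) refl (x ^ suc m) (x ^ suc (suc m))
  binomial-mirror x (suc n) zero = begin
    1# * (1# + x ^ 1 * binomial x (suc n) 1)
      ≈⟨ solve 2 (λ x g → con 1ℤ :* (con 1ℤ :+ x :^ 1 :* g)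
                       := con 1ℤ :+ x :* (con 1ℤ :* g)) refl _ _ ⟩
    1# + x * (1# * binomial x (suc n) 1)
      ≈⟨ +-congˡ (*-congˡ (binomial-mirror x n zero)) ⟩
    1# + x * (x ^ n * 1# + 1# * binomial x n 1)
      ≈⟨ solve 3 (λ x y g → con 1ℤ :+ x :* (y :* con 1ℤ :+ con 1ℤ :* g)
            := x :* y :* con 1ℤ :+ con 1ℤ :* (con 1ℤ :+ x :^ 1 :* g)) refl _ _ _ ⟩
    x ^ suc n * 1# + 1# * (1# + x ^ 1 * binomial x n 1) ∎
  binomial-mirror x (suc n) (suc m) = begin
    x * x ^ m * (g₁ + x * (x * x ^ m) * g₂)
      ≈⟨ solve 4 (λ x y g h → x :* y :* (g :+ x :* (x :* y) :* h)
           := x :* (y :* g) :+ x :* x :* y :* (x :* y :* h)) refl x (x ^ m) g₁ g₂ ⟩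
    x * (x ^ m * g₁) + x * x * x ^ m * (x * x ^ m * g₂)
      ≈⟨ +-cong (*-congˡ (binomial-mirror x n m)) (*-congˡ (binomial-mirror x n (suc m))) ⟩
    x * (x ^ n * f₀ + x ^ m * f₁) + x * x * x ^ m * (x ^ n * f₁ + x * x ^ m * f₂)
      ≈⟨ solve 6 (λ x y z f₀ f₁ f₂ →
           x :* (z :* f₀ :+ y :* f₁) :+ x :* x :* y :* (z :* f₁ :+ x :* y :* f₂)
           := x :* z :* (f₀ :+ x :* y :* f₁) :+ x :* y :* (f₁ :+ x :* (x :* y) :* f₂))
         refl x (x ^ m) (x ^ n) f₀ f₁ f₂ ⟩
    x * x ^ n * (f₀ + x * x ^ m * f₁) + x * x ^ m * (f₁ + x * (x * x ^ m) * f₂) ∎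
    where
    f₀ = binomial x n m
    f₁ = binomial x n (suc m)
    f₂ = binomial x n (suc (suc m))
    g₁ = binomial x (suc n) (suc m)
    g₂ = binomial x (suc n) (suc (suc m))

  binomial-diagonal : ∀ x n → binomial x n n ≈ 1#
  binomial-diagonal x zero    = refl
  binomial-diagonal x (suc n) = begin
    binomial x n n + x ^ suc n * binomial x n (suc n)
      ≈⟨ +-cong (binomial-diagonal x n) (*-congˡ (binomial-zero x (ℕ.n<1+n n))) ⟩
    1# + x ^ suc n * 0#
      ≈⟨ solve 1 (λ y → con 1ℤ :+ y :* con 0ℤ := con 1ℤ) refl _ ⟩
    1# ∎

  -- Both Pascal summands reduce to the same product `p`, with the factors 1 - x^(m+1) and x^(m+1)
  -- (1 - x^(n+1)). These add up to 1 - x^(m+n+2), the last factor of the product on the right.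
  binomial-pochhammer : ∀ x m n →
    ⟨ x ⨾ x ⟩ m * ⟨ x ⨾ x ⟩ n * binomial x (m ℕ.+ n) m ≈ ⟨ x ⨾ x ⟩ (m ℕ.+ n)
  binomial-pochhammer x zero n =
    solve 1 (λ p → con 1ℤ :* p :* con 1ℤ := p) refl (⟨ x ⨾ x ⟩ n)
  binomial-pochhammer x (suc m) zero rewrite ℕ.+-identityʳ m = begin
    p * 1# * binomial x (suc m) (suc m)
      ≈⟨ *-congˡ (binomial-diagonal x (suc m)) ⟩
    p * 1# * 1#
      ≈⟨ solve 1 (λ p → p :* con 1ℤ :* con 1ℤ := p) refl p ⟩
    p ∎
    where p = ⟨ x ⨾ x ⟩ (suc m)
  binomial-pochhammer x (suc m) (suc n) = begin
    ⟨ x ⨾ x ⟩ (suc m) * ⟨ x ⨾ x ⟩ (suc n) * (g₀ + x ^ suc m * g₁)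
      ≈⟨ solve 5 (λ p q y g h → p :* q :* (g :+ y :* h)
                   := p :* q :* g :+ y :* (p :* q :* h)) refl _ _ _ _ _ ⟩
    ⟨ x ⨾ x ⟩ (suc m) * ⟨ x ⨾ x ⟩ (suc n) * g₀
      + x ^ suc m * (⟨ x ⨾ x ⟩ (suc m) * ⟨ x ⨾ x ⟩ (suc n) * g₁)
      ≈⟨ +-cong (*-congʳ (*-congʳ (pochhammer-last x x m)))
                (*-congˡ (*-congʳ (*-congˡ (pochhammer-last x x n)))) ⟩
    ⟨ x ⨾ x ⟩ m * (1# - x * x ^ m) * ⟨ x ⨾ x ⟩ (suc n) * g₀
      + x ^ suc m * (⟨ x ⨾ x ⟩ (suc m) * (⟨ x ⨾ x ⟩ n * (1# - x * x ^ n)) * g₁)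
      ≈⟨ solve 9 (λ x y z a b c d g h →
           a :* (con 1ℤ :- x :* y) :* b :* g :+ x :* y :* (c :* (d :* (con 1ℤ :- x :* z)) :* h)
           := (con 1ℤ :- x :* y) :* (a :* b :* g) :+ x :* y :* (con 1ℤ :- x :* z) :* (c :* d :* h))
         refl x (x ^ m) (x ^ n) (⟨ x ⨾ x ⟩ m) (⟨ x ⨾ x ⟩ (suc n))
              (⟨ x ⨾ x ⟩ (suc m)) (⟨ x ⨾ x ⟩ n) g₀ g₁ ⟩
    (1# - x * x ^ m) * (⟨ x ⨾ x ⟩ m * ⟨ x ⨾ x ⟩ (suc n) * g₀)
      + x * x ^ m * (1# - x * x ^ n) * (⟨ x ⨾ x ⟩ (suc m) * ⟨ x ⨾ x ⟩ n * g₁)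
      ≈⟨ +-cong (*-congˡ (binomial-pochhammer x m (suc n))) (*-congˡ ih₁) ⟩
    (1# - x * x ^ m) * p + x * x ^ m * (1# - x * x ^ n) * p
      ≈⟨ solve 4 (λ x y z p → (con 1ℤ :- x :* y) :* p :+ x :* y :* (con 1ℤ :- x :* z) :* p
                   := p :* (con 1ℤ :- x :* (y :* (x :* z)))) refl x (x ^ m) (x ^ n) p ⟩
    p * (1# - x * (x ^ m * (x * x ^ n)))
      ≈⟨ *-congˡ (+-congˡ (-‿cong (*-congˡ (^-homo-* x m (suc n))))) ⟨
    p * (1# - x * x ^ (m ℕ.+ suc n))
      ≈⟨ pochhammer-last x x (m ℕ.+ suc n) ⟨
    ⟨ x ⨾ x ⟩ (suc (m ℕ.+ suc n)) ∎
    where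
    p  = ⟨ x ⨾ x ⟩ (m ℕ.+ suc n)
    g₀ = binomial x (m ℕ.+ suc n) m
    g₁ = binomial x (m ℕ.+ suc n) (suc m)
    ih₁ : ⟨ x ⨾ x ⟩ (suc m) * ⟨ x ⨾ x ⟩ n * g₁ ≈ p
    ih₁ rewrite ℕ.+-suc m n = binomial-pochhammer x (suc m) n

  -- The binomial [n+i-1 i], with the convention [-1 0] = 1.
  multichoose : Carrier → ℕ → ℕ → Carrier
  multichoose x zero    zero    = 1#
  multichoose x zero    (suc i) = 0#
  multichoose x (suc n) i       = binomial x (n ℕ.+ i) i

  multichoose-0 : ∀ x n → multichoose x n 0 ≈ 1#
  multichoose-0 x zero    = refl
  multichoose-0 x (suc n) = refl

  multichoose≈binomial : ∀ x n i → multichoose x n (suc i) ≈ binomial x (n ℕ.+ i) (suc i)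
  multichoose≈binomial x zero    i = sym (binomial-zero x (ℕ.n<1+n i))
  multichoose≈binomial x (suc n) i = reflexive (≡.cong (λ m → binomial x m (suc i)) (ℕ.+-suc n i))

  multichoose-suc : ∀ x n i →
    multichoose x (suc n) (suc i) ≈ multichoose x (suc n) i + x ^ suc i * multichoose x n (suc i)
  multichoose-suc x n i = begin
    binomial x (n ℕ.+ suc i) (suc i)
      ≡⟨ ≡.cong (λ m → binomial x m (suc i)) (ℕ.+-suc n i) ⟩
    binomial x (n ℕ.+ i) i + x ^ suc i * binomial x (n ℕ.+ i) (suc i)
      ≈⟨ +-congˡ (*-congˡ (multichoose≈binomial x n i)) ⟨
    binomial x (n ℕ.+ i) i + x ^ suc i * multichoose x n (suc i) ∎

  -- The mirror rule, whose weight `x ^ n` does not depend on i and can be pulled out of a sum over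
  -- i, unlike the weight in `multichoose-suc`. `binomial-mirror` gives it only up to the factor
  -- `x ^ i`, which the inverse `y` cancels.
  multichoose-suc′ : ∀ {x y} → x * y ≈ 1# → ∀ n i →
    multichoose x (suc n) (suc i) ≈ multichoose x n (suc i) + x ^ n * multichoose x (suc n) i
  multichoose-suc′ {x} {y} xy≈1 n i = begin
    binomial x (n ℕ.+ suc i) (suc i)
      ≡⟨ ≡.cong (λ m → binomial x m (suc i)) (ℕ.+-suc n i) ⟩
    binomial x (suc (n ℕ.+ i)) (suc i)
      ≈⟨ cancel _ ⟨
    y ^ i * (x ^ i * binomial x (suc (n ℕ.+ i)) (suc i))
      ≈⟨ *-congˡ (binomial-mirror x (n ℕ.+ i) i) ⟩
    y ^ i * (x ^ (n ℕ.+ i) * binomial x (n ℕ.+ i) i + x ^ i * binomial x (n ℕ.+ i) (suc i))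
      ≈⟨ *-congˡ (+-congʳ (*-congʳ (^-homo-* x n i))) ⟩
    y ^ i * (x ^ n * x ^ i * binomial x (n ℕ.+ i) i + x ^ i * binomial x (n ℕ.+ i) (suc i))
      ≈⟨ solve 5 (λ y z x g h → y :* (z :* x :* g :+ x :* h)
                             := y :* (x :* h) :+ z :* (y :* (x :* g))) refl _ _ _ _ _ ⟩
    y ^ i * (x ^ i * binomial x (n ℕ.+ i) (suc i)) + x ^ n * (y ^ i * (x ^ i * binomial x (n ℕ.+ i) i))
      ≈⟨ +-cong (cancel _) (*-congˡ (cancel _)) ⟩
    binomial x (n ℕ.+ i) (suc i) + x ^ n * binomial x (n ℕ.+ i) i
      ≈⟨ +-congʳ (multichoose≈binomial x n i) ⟨
    multichoose x n (suc i) + x ^ n * binomial x (n ℕ.+ i) i ∎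
    where
    cancel : ∀ g → y ^ i * (x ^ i * g) ≈ g
    cancel g = begin
      y ^ i * (x ^ i * g)    ≈⟨ solve 3 (λ y x g → y :* (x :* g) := x :* y :* g) refl _ _ _ ⟩
      x ^ i * y ^ i * g      ≈⟨ *-congʳ (^-inverse xy≈1 i) ⟩
      1# * g                 ≈⟨ *-identityˡ g ⟩
      g                      ∎

[1+m+n]∸m∸1≡n : ∀ m n → suc (m ℕ.+ n) ℕ.∸ m ℕ.∸ 1 ≡ n
[1+m+n]∸m∸1≡n m n = ≡.cong (ℕ._∸ 1)
  (≡.trans (≡.cong (ℕ._∸ m) (≡.sym (ℕ.+-suc m n))) (ℕ.m+n∸m≡n m (suc n)))

-- The values at t = s q^b.

module PositivePowers {c ℓ} (R : CommutativeRing c ℓ) where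
  open CommutativeRing R hiding (_-_; zero)
  open RingNotions rawRing
  open IntegerSolver R
  open RingLemmas R
  open GaussianBinomials R
  open Algebra.Properties.CommutativeSemiring.Exp commutativeSemiring
    using (^-homo-*; ^-assocʳ)
  open Relation.Binary.Reasoning.Setoid setoid

  module _ (s q : Carrier) where

    -- The value of tailSum⁺ at k = 0 makes tailSum⁺-suc hold for all k.
    headSum⁺ tailSum⁺ : ℕ → ℕ → Carrier
    headSum⁺ b k = ∑[ i < k ] (q ^ (i ℕ.* (2 ℕ.* k ℕ.+ 1)) * binomial (q ^ 2) b i * T (k ℕ.∸ i) s q)
    tailSum⁺ b zero    = ⟨ s * q ⨾ q ⟩ b
    tailSum⁺ b (suc k) = ∑[ i < b ] (⟨ s * q ⨾ q ⟩ i * q ^ (suc k ℕ.* (2 ℕ.* suc k ℕ.+ 2 ℕ.* i ℕ.+ 1))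
                                      * binomial (q ^ 2) (b ℕ.∸ i ℕ.∸ 1) k)

    -- t² q^{2k+3} at t = s q^b.
    step⁺ : ℕ → ℕ → Carrier
    step⁺ b k = q ^ (2 ℕ.* k ℕ.+ 3 ℕ.+ 2 ℕ.* b)

    -- The factor q ^ e contains the x ^ m = q ^ (2 m) of binomial-mirror.
    binomial-mirror-q² : ∀ n m {e e′} r → e ≡ 2 ℕ.* m ℕ.+ r → e′ ≡ 2 ℕ.* n ℕ.+ r →
      q ^ e * binomial (q ^ 2) (suc n) (suc m)
        ≈ q ^ e * binomial (q ^ 2) n (suc m) + q ^ e′ * binomial (q ^ 2) n m
    binomial-mirror-q² n m {e} {e′} r e≡ e′≡ = begin
      q ^ e * binomial (q ^ 2) (suc n) (suc m)
        ≈⟨ *-congʳ (split m e≡) ⟩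
      (q ^ 2) ^ m * q ^ r * binomial (q ^ 2) (suc n) (suc m)
        ≈⟨ solve 3 (λ a b c → a :* b :* c := b :* (a :* c)) refl _ _ _ ⟩
      q ^ r * ((q ^ 2) ^ m * binomial (q ^ 2) (suc n) (suc m))
        ≈⟨ *-congˡ (binomial-mirror (q ^ 2) n m) ⟩
      q ^ r * ((q ^ 2) ^ n * binomial (q ^ 2) n m + (q ^ 2) ^ m * binomial (q ^ 2) n (suc m))
        ≈⟨ solve 5 (λ r x g y h → r :* (x :* g :+ y :* h) := y :* r :* h :+ x :* r :* g)
             refl _ _ _ _ _ ⟩
      (q ^ 2) ^ m * q ^ r * binomial (q ^ 2) n (suc m) + (q ^ 2) ^ n * q ^ r * binomial (q ^ 2) n m
        ≈⟨ +-cong (*-congʳ (split m e≡)) (*-congʳ (split n e′≡)) ⟨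
      q ^ e * binomial (q ^ 2) n (suc m) + q ^ e′ * binomial (q ^ 2) n m ∎
      where
      split : ∀ m {e} → e ≡ 2 ℕ.* m ℕ.+ r → q ^ e ≈ (q ^ 2) ^ m * q ^ r
      split m e≡ = trans (^-split q (2 ℕ.* m) r e≡) (*-congʳ (sym (^-assocʳ q 2 m)))

    -- The i = 0 term does not depend on b. Every later term splits by the mirror rule, the one
    -- whose weight grows with b as `step⁺` does; the second half of term i+1 is `step⁺ b k` times
    -- term i of `headSum⁺ b k`, since both carry T_(k-i)(s).
    headSum⁺-suc : ∀ b k → headSum⁺ (suc b) (suc k) ≈ headSum⁺ b (suc k) + step⁺ b k * headSum⁺ b k
    headSum⁺-suc b k = begin
      h + ∑[ i < k ] (q ^ e i * binomial (q ^ 2) (suc b) (suc i) * T (k ℕ.∸ i) s q)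
        ≈⟨ +-congˡ (∑-cong k term) ⟩
      h + ∑[ i < k ] (old i + step⁺ b k * new i)
        ≈⟨ +-congˡ (trans (∑-+ k old (λ i → step⁺ b k * new i)) (+-congˡ (∑-*ˡ k (step⁺ b k) new))) ⟩
      h + (∑[ i < k ] old i + step⁺ b k * ∑[ i < k ] new i)
        ≈⟨ +-assoc _ _ _ ⟨
      h + ∑[ i < k ] old i + step⁺ b k * ∑[ i < k ] new i ∎
      where
      e : ℕ → ℕ
      e i = suc i ℕ.* (2 ℕ.* suc k ℕ.+ 1)
      h = 1# * 1# * T (suc k) s q
      old new : ℕ → Carrier
      old i = q ^ e i * binomial (q ^ 2) b (suc i) * T (k ℕ.∸ i) s q
      new i = q ^ (i ℕ.* (2 ℕ.* k ℕ.+ 1)) * binomial (q ^ 2) b i * T (k ℕ.∸ i) s q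
      term : ∀ i → q ^ e i * binomial (q ^ 2) (suc b) (suc i) * T (k ℕ.∸ i) s q
                 ≈ old i + step⁺ b k * new i
      term i = begin
        q ^ e i * binomial (q ^ 2) (suc b) (suc i) * T (k ℕ.∸ i) s q
          ≈⟨ *-congʳ (binomial-mirror-q² b i (i ℕ.* (2 ℕ.* k ℕ.+ 1) ℕ.+ 2 ℕ.* k ℕ.+ 3)
               (NatExponents.head-split k i)
               (NatExponents.head-merge b k i)) ⟩
        (q ^ e i * binomial (q ^ 2) b (suc i)
          + q ^ (2 ℕ.* k ℕ.+ 3 ℕ.+ 2 ℕ.* b ℕ.+ i ℕ.* (2 ℕ.* k ℕ.+ 1)) * binomial (q ^ 2) b i)
          * T (k ℕ.∸ i) s q
          ≈⟨ *-congʳ (+-congˡ (*-congʳ (^-homo-* q (2 ℕ.* k ℕ.+ 3 ℕ.+ 2 ℕ.* b) (i ℕ.* (2 ℕ.* k ℕ.+ 1))))) ⟩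
        (q ^ e i * binomial (q ^ 2) b (suc i)
          + step⁺ b k * q ^ (i ℕ.* (2 ℕ.* k ℕ.+ 1)) * binomial (q ^ 2) b i) * T (k ℕ.∸ i) s q
          ≈⟨ solve 6 (λ x g y z h t → (x :* g :+ y :* z :* h) :* t
                        := x :* g :* t :+ y :* (z :* h :* t)) refl _ _ _ _ _ _ ⟩
        old i + step⁺ b k * new i ∎

    -- Raising b splits the old terms and adds the term i = b. For `k = 0` the binomials are all 1
    -- and nothing splits: the new term alone is `step⁺ b 0` times (s q; q)_b, the chosen value of
    -- `tailSum⁺ b 0`. For larger k the new term contains [0 k+1] = 0.
    tailSum⁺-suc : ∀ b k → tailSum⁺ (suc b) (suc k) ≈ tailSum⁺ b (suc k) + step⁺ b k * tailSum⁺ b k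
    tailSum⁺-suc b zero = begin
      tailSum⁺ (suc b) 1
        ≈⟨ ∑-last b (λ i → ⟨ s * q ⨾ q ⟩ i * q ^ (1 ℕ.* (2 ℕ.+ 2 ℕ.* i ℕ.+ 1)) * 1#) ⟩
      tailSum⁺ b 1 + ⟨ s * q ⨾ q ⟩ b * q ^ (1 ℕ.* (2 ℕ.+ 2 ℕ.* b ℕ.+ 1)) * 1#
        ≈⟨ +-congˡ (trans (*-identityʳ _) (*-comm _ _)) ⟩
      tailSum⁺ b 1 + q ^ (1 ℕ.* (2 ℕ.+ 2 ℕ.* b ℕ.+ 1)) * ⟨ s * q ⨾ q ⟩ b
        ≈⟨ +-congˡ (*-congʳ (^-≡ q (NatExponents.tail-one b))) ⟩
      tailSum⁺ b 1 + step⁺ b 0 * ⟨ s * q ⨾ q ⟩ b ∎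
    tailSum⁺-suc b (suc k) = begin
      tailSum⁺ (suc b) (suc (suc k))
        ≈⟨ ∑-last b f ⟩
      ∑[ i < b ] f i + f b
        ≈⟨ +-cong (∑-cong< b term)
                  (*-congˡ (reflexive (≡.cong (λ n → binomial (q ^ 2) n (suc k)) b+1∸b∸1))) ⟩
      ∑[ i < b ] (old i + step⁺ b (suc k) * new i) + coeff-b * 0#
        ≈⟨ +-cong (trans (∑-+ b old (λ i → step⁺ b (suc k) * new i))
                         (+-congˡ (∑-*ˡ b (step⁺ b (suc k)) new)))
                  (zeroʳ coeff-b) ⟩
      tailSum⁺ b (suc (suc k)) + step⁺ b (suc k) * tailSum⁺ b (suc k) + 0#
        ≈⟨ +-identityʳ _ ⟩
      tailSum⁺ b (suc (suc k)) + step⁺ b (suc k) * tailSum⁺ b (suc k) ∎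
      where
      e e′ : ℕ → ℕ
      e  i = suc (suc k) ℕ.* (2 ℕ.* suc (suc k) ℕ.+ 2 ℕ.* i ℕ.+ 1)
      e′ i = suc k ℕ.* (2 ℕ.* suc k ℕ.+ 2 ℕ.* i ℕ.+ 1)
      f old new : ℕ → Carrier
      f   i = ⟨ s * q ⨾ q ⟩ i * q ^ e  i * binomial (q ^ 2) (suc b ℕ.∸ i ℕ.∸ 1) (suc k)
      old i = ⟨ s * q ⨾ q ⟩ i * q ^ e  i * binomial (q ^ 2) (b ℕ.∸ i ℕ.∸ 1) (suc k)
      new i = ⟨ s * q ⨾ q ⟩ i * q ^ e′ i * binomial (q ^ 2) (b ℕ.∸ i ℕ.∸ 1) k
      coeff-b = ⟨ s * q ⨾ q ⟩ b * q ^ e b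
      b+1∸b∸1 : suc b ℕ.∸ b ℕ.∸ 1 ≡ 0
      b+1∸b∸1 = ≡.cong (ℕ._∸ 1) (ℕ.m+n∸n≡m 1 b)

      -- Writing b = i + n + 1 removes the truncated subtractions: the tops of the binomials for b+1
      -- and b become n+1 and n.
      term′ : ∀ i n {m l} → b ≡ suc (i ℕ.+ n) → m ≡ suc n → l ≡ n →
        ⟨ s * q ⨾ q ⟩ i * q ^ e i * binomial (q ^ 2) m (suc k)
          ≈ ⟨ s * q ⨾ q ⟩ i * q ^ e i * binomial (q ^ 2) l (suc k)
            + step⁺ b (suc k) * (⟨ s * q ⨾ q ⟩ i * q ^ e′ i * binomial (q ^ 2) l k)
      term′ i n ≡.refl ≡.refl ≡.refl = begin
        ⟨ s * q ⨾ q ⟩ i * q ^ e i * binomial (q ^ 2) (suc n) (suc k)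
          ≈⟨ *-assoc _ _ _ ⟩
        ⟨ s * q ⨾ q ⟩ i * (q ^ e i * binomial (q ^ 2) (suc n) (suc k))
          ≈⟨ *-congˡ (binomial-mirror-q² n k (2 ℕ.* k ℕ.+ 2 ℕ.* i ℕ.+ 7 ℕ.+ e′ i)
              (NatExponents.tail-split k i)
              (NatExponents.tail-merge k i n (e′ i))) ⟩
        ⟨ s * q ⨾ q ⟩ i * (q ^ e i * binomial (q ^ 2) n (suc k)
          + q ^ (2 ℕ.* suc k ℕ.+ 3 ℕ.+ 2 ℕ.* suc (i ℕ.+ n) ℕ.+ e′ i) * binomial (q ^ 2) n k)
          ≈⟨ *-congˡ (+-congˡ (*-congʳ (^-homo-* q (2 ℕ.* suc k ℕ.+ 3 ℕ.+ 2 ℕ.* suc (i ℕ.+ n)) (e′ i)))) ⟩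
        ⟨ s * q ⨾ q ⟩ i * (q ^ e i * binomial (q ^ 2) n (suc k)
          + step⁺ b (suc k) * q ^ e′ i * binomial (q ^ 2) n k)
          ≈⟨ solve 6 (λ p x g y z h → p :* (x :* g :+ y :* z :* h)
                 := p :* x :* g :+ y :* (p :* z :* h)) refl _ _ _ _ _ _ ⟩
        ⟨ s * q ⨾ q ⟩ i * q ^ e i * binomial (q ^ 2) n (suc k)
          + step⁺ b (suc k) * (⟨ s * q ⨾ q ⟩ i * q ^ e′ i * binomial (q ^ 2) n k) ∎

      term : ∀ i → i ℕ.< b → f i ≈ old i + step⁺ b (suc k) * new i
      term i i<b with n , ≡.refl ← ℕ.m≤n⇒∃[o]m+o≡n i<b =
        term′ i n ≡.refl
          (≡.trans (≡.cong (λ m → suc m ℕ.∸ i ℕ.∸ 1) (≡.sym (ℕ.+-suc i n))) ([1+m+n]∸m∸1≡n i (suc n)))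
          ([1+m+n]∸m∸1≡n i n)

    -- Passing from b to b+1 multiplies (s q; q)_b by 1 - s q^(b+1), which is exactly the 1 - t q of
    -- `T-descent` at t = s q^b. Hence no denominator arises. The hypothesis on s turns t² into
    -- q^(2b).
    T-positive : s * s ≈ 1# → ∀ b k →
      ⟨ s * q ⨾ q ⟩ b * T k (s * q ^ b) q ≈ headSum⁺ b k + tailSum⁺ b k
    T-positive _ b zero = trans (*-identityʳ _) (sym (+-identityˡ _))
    T-positive _ zero (suc k) = begin
      1# * T (suc k) (s * 1#) q
        ≈⟨ *-congˡ (T-cong (suc k) q (*-identityʳ s)) ⟩
      1# * T (suc k) s q
        ≈⟨ solve 1 (λ t → con 1ℤ :* t := con 1ℤ :* con 1ℤ :* t :+ con 0ℤ :+ con 0ℤ) refl _ ⟩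
      1# * 1# * T (suc k) s q + 0# + 0#
        ≈⟨ +-congʳ (+-congˡ (trans
             (∑-cong k {λ i → q ^ (suc i ℕ.* (2 ℕ.* suc k ℕ.+ 1)) * 0# * T (k ℕ.∸ i) s q}
               λ i → trans (*-congʳ (zeroʳ _)) (zeroˡ _)) (∑-zero k))) ⟨
      headSum⁺ 0 (suc k) + tailSum⁺ 0 (suc k) ∎
    T-positive s²≈1 (suc b) (suc k) = begin
      ⟨ s * q ⨾ q ⟩ (suc b) * T (suc k) (s * q ^ suc b) q
        ≈⟨ *-cong (pochhammer-last (s * q) q b)
                  (T-cong (suc k) q (solve 3 (λ s q x → s :* (q :* x) := s :* x :* q) refl s q (q ^ b))) ⟩
      p * (1# - s * q * q ^ b) * T (suc k) (t * q) q
        ≈⟨ solve 5 (λ p s q x t → p :* (con 1ℤ :- s :* q :* x) :* t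
              := p :* ((con 1ℤ :- s :* x :* q) :* t)) refl p s q (q ^ b) _ ⟩
      p * ((1# - t * q) * T (suc k) (t * q) q)
        ≈⟨ *-congˡ (T-descent k t q) ⟩
      p * (T (suc k) t q + t ^ 2 * q ^ suc (2 ℕ.* suc k) * T k t q)
        ≈⟨ *-congˡ (+-congˡ (*-congʳ t²q^)) ⟩
      p * (T (suc k) t q + step⁺ b k * T k t q)
        ≈⟨ solve 4 (λ p a x b → p :* (a :+ x :* b) := p :* a :+ x :* (p :* b)) refl _ _ _ _ ⟩
      p * T (suc k) t q + step⁺ b k * (p * T k t q)
        ≈⟨ +-cong (T-positive s²≈1 b (suc k)) (*-congˡ (T-positive s²≈1 b k)) ⟩
      headSum⁺ b (suc k) + tailSum⁺ b (suc k) + step⁺ b k * (headSum⁺ b k + tailSum⁺ b k)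
        ≈⟨ solve 5 (λ a b x c d → a :+ b :+ x :* (c :+ d) := a :+ x :* c :+ (b :+ x :* d)) refl _ _ _ _ _ ⟩
      headSum⁺ b (suc k) + step⁺ b k * headSum⁺ b k + (tailSum⁺ b (suc k) + step⁺ b k * tailSum⁺ b k)
        ≈⟨ +-cong (headSum⁺-suc b k) (tailSum⁺-suc b k) ⟨
      headSum⁺ (suc b) (suc k) + tailSum⁺ (suc b) (suc k) ∎
      where
      p = ⟨ s * q ⨾ q ⟩ b
      t = s * q ^ b
      t²q^ : t ^ 2 * q ^ suc (2 ℕ.* suc k) ≈ step⁺ b k
      t²q^ = begin
        (s * q ^ b) ^ 2 * q ^ suc (2 ℕ.* suc k)
          ≈⟨ solve 3 (λ s x y → (s :* x) :^ 2 :* y := s :* s :* (y :* x :^ 2)) refl s (q ^ b) _ ⟩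
        s * s * (q ^ suc (2 ℕ.* suc k) * (q ^ b) ^ 2)
          ≈⟨ *-cong s²≈1 (*-congˡ (^-assocʳ q b 2)) ⟩
        1# * (q ^ suc (2 ℕ.* suc k) * q ^ (b ℕ.* 2))
          ≈⟨ trans (*-identityˡ _) (sym (^-split q (suc (2 ℕ.* suc k)) (b ℕ.* 2)
               (NatExponents.descent b k))) ⟩
        step⁺ b k ∎

-- Integer powers relative to a given inverse.

module IntegerPowers {c ℓ} (R : CommutativeRing c ℓ) where
  open CommutativeRing R hiding (_-_; zero)
  open RingNotions rawRing
  open IntegerSolver R
  open RingLemmas R
  open Algebra.Properties.CommutativeSemiring.Exp commutativeSemiring
    using (^-congˡ; ^-homo-*)
  open Relation.Binary.Reasoning.Setoid setoid

  -- v plays the role of the inverse of u.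
  zpow : Carrier → Carrier → ℤ → Carrier
  zpow u v (+ n)    = u ^ n
  zpow u v -[1+ n ] = v ^ suc n

  zpow-cong : ∀ {u u′ v v′} → u ≈ u′ → v ≈ v′ → ∀ i → zpow u v i ≈ zpow u′ v′ i
  zpow-cong u≈ v≈ (+ n)    = ^-congˡ n u≈
  zpow-cong u≈ v≈ -[1+ n ] = ^-congˡ (suc n) v≈

  zpow-neg : ∀ u v n → zpow u v (ℤ.- + n) ≈ v ^ n
  zpow-neg u v zero    = refl
  zpow-neg u v (suc n) = refl

  module _ {u v} (uv≈1 : u * v ≈ 1#) where

    zpow-⊖ : ∀ m n → zpow u v (m ℤ.⊖ n) ≈ u ^ m * v ^ n
    zpow-⊖ m       zero    = sym (*-identityʳ _)
    zpow-⊖ zero    (suc n) = sym (*-identityˡ _)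
    zpow-⊖ (suc m) (suc n) = begin
      zpow u v (suc m ℤ.⊖ suc n)    ≡⟨ ≡.cong (zpow u v) (ℤ.[1+m]⊖[1+n]≡m⊖n m n) ⟩
      zpow u v (m ℤ.⊖ n)            ≈⟨ zpow-⊖ m n ⟩
      u ^ m * v ^ n                 ≈⟨ *-identityˡ _ ⟨
      1# * (u ^ m * v ^ n)          ≈⟨ *-congʳ uv≈1 ⟨
      u * v * (u ^ m * v ^ n)
        ≈⟨ solve 4 (λ u v x y → u :* v :* (x :* y) := u :* x :* (v :* y)) refl u v _ _ ⟩
      u * u ^ m * (v * v ^ n)       ∎

    zpow-+ : ∀ i j → zpow u v (i ℤ.+ j) ≈ zpow u v i * zpow u v j
    zpow-+ (+ m)    (+ n)    = ^-homo-* u m n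
    zpow-+ (+ m)    -[1+ n ] = zpow-⊖ m (suc n)
    zpow-+ -[1+ m ] (+ n)    = trans (zpow-⊖ n (suc m)) (*-comm _ _)
    zpow-+ -[1+ m ] -[1+ n ] =
      ^-split v (suc m) (suc n) (≡.cong suc (≡.sym (ℕ.+-suc m n)))

    zpow-split : ∀ {l} i j → l ≡ i ℤ.+ j → zpow u v l ≈ zpow u v i * zpow u v j
    zpow-split i j ≡.refl = zpow-+ i j

-- The values at t = s q^(-b).

module NegativePowers {c ℓ} (R : CommutativeRing c ℓ) where
  open CommutativeRing R hiding (_-_; zero)
  open RingNotions rawRing
  open IntegerSolver R
  open RingLemmas R
  open GaussianBinomials R
  open IntegerPowers R
  open Algebra.Properties.CommutativeSemiring.Exp commutativeSemiring
    using (^-homo-*; ^-assocʳ)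
  open Relation.Binary.Reasoning.Setoid setoid

  module Descent (q p : Carrier) (qp≈1 : q * p ≈ 1#) where

    -- Powers are taken of -q because the claimed exponents can be odd as well as negative; even
    -- powers of q and p are converted by `q^2*` and `p^2*`.
    Q : ℤ → Carrier
    Q = zpow (- q) (- p)

    -q*-p≈1 : - q * - p ≈ 1#
    -q*-p≈1 = trans (solve 2 (λ q p → :- q :* :- p := q :* p) refl q p) qp≈1

    Q-split : ∀ {l} i j → l ≡ i ℤ.+ j → Q l ≈ Q i * Q j
    Q-split = zpow-split -q*-p≈1

    q^2* : ∀ n → q ^ (2 ℕ.* n) ≈ Q (+ 2 ℤ.* + n)
    q^2* n = begin
      q ^ (2 ℕ.* n)      ≈⟨ neg-^-even q n ⟨
      Q (+ (2 ℕ.* n))    ≡⟨ ≡.cong Q (ℤ.pos-* 2 n) ⟩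
      Q (+ 2 ℤ.* + n)    ∎

    [q²]^ : ∀ n → (q ^ 2) ^ n ≈ Q (+ 2 ℤ.* + n)
    [q²]^ n = trans (^-assocʳ q 2 n) (q^2* n)

    p^2* : ∀ n → p ^ (2 ℕ.* n) ≈ Q (ℤ.- (+ 2 ℤ.* + n))
    p^2* n = begin
      p ^ (2 ℕ.* n)              ≈⟨ neg-^-even p n ⟨
      (- p) ^ (2 ℕ.* n)          ≈⟨ zpow-neg (- q) (- p) (2 ℕ.* n) ⟨
      Q (ℤ.- (+ (2 ℕ.* n)))      ≡⟨ ≡.cong (λ i → Q (ℤ.- i)) (ℤ.pos-* 2 n) ⟩
      Q (ℤ.- (+ 2 ℤ.* + n))      ∎

    -- s q^{1-b}
    base : Carrier → ℕ → Carrier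
    base s b = s * (p ^ b * q)

    headExponent : ℕ → ℕ → ℕ → ℤ
    headExponent b k i = + i ℤ.* (+ 2 ℤ.* + k ℤ.- + 2 ℤ.* + b ℤ.- + i ℤ.+ + 2)

    tailExponent : ℕ → ℕ → ℤ
    tailExponent b k = + k ℤ.* (+ k ℤ.- + 2 ℤ.* + b ℤ.+ + 2)

    headSum⁻ tailSum⁻ : Carrier → ℕ → ℕ → Carrier
    headSum⁻ s b k = ∑[ i < k ] (Q (headExponent b k i) * multichoose (q ^ 2) b i * T (k ℕ.∸ i) s q)
    tailSum⁻ s b k = ∑[ i < b ] (⟨ base s b ⨾ q ⟩ i * q ^ (2 ℕ.* i) * multichoose (q ^ 2) k i)

    -- - t² q^{2k+3} at t = s q^{-b}.
    step⁻ : ℕ → ℕ → Carrier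
    step⁻ b k = Q (+ 2 ℤ.* + k ℤ.+ + 3 ℤ.- + 2 ℤ.* + b)

    base-suc : ∀ s b → base s (suc b) * q ≈ base s b
    base-suc s b = begin
      s * (p * p ^ b * q) * q
        ≈⟨ solve 4 (λ s p y q → s :* (p :* y :* q) :* q := q :* p :* (s :* (y :* q))) refl s p _ q ⟩
      q * p * base s b    ≈⟨ *-congʳ qp≈1 ⟩
      1# * base s b       ≈⟨ *-identityˡ _ ⟩
      base s b            ∎

    -- Raising b divides the base by q, so the new factor appears at the front of the product and
    -- the remaining factors are those for b.
    pochhammer-base : ∀ s b n →
      ⟨ base s (suc b) ⨾ q ⟩ (suc n) ≈ (1# - base s (suc b)) * ⟨ base s b ⨾ q ⟩ n
    pochhammer-base s b n =
      trans (pochhammer-first (base s (suc b)) q n) (*-congˡ (pochhammer-cong q n (base-suc s b)))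

    -- By `multichoose-suc`, term i+1 splits in two. One half is `step⁻` times term i for (b+1, k);
    -- in the other the weight q^(2(i+1)) makes up exactly for the change of `headExponent` from b+1
    -- to b.
    headSum⁻-suc : ∀ s b k → headSum⁻ s (suc b) (suc k)
      ≈ headSum⁻ s b (suc k) + step⁻ (suc b) k * headSum⁻ s (suc b) k
    headSum⁻-suc s b k = begin
      1# * 1# * t + ∑< k f
        -- The term i = 0 is the same for every b; at b = 0 this is the convention [-1 0] = 1.
        ≈⟨ +-cong (*-congʳ (*-congˡ (sym (multichoose-0 (q ^ 2) b)))) (∑-cong k term) ⟩
      h + ∑[ i < k ] (old i + w * new i)
        ≈⟨ +-congˡ (trans (∑-+ k old (λ i → w * new i)) (+-congˡ (∑-*ˡ k w new))) ⟩
      h + (∑< k old + w * ∑< k new)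
        ≈⟨ +-assoc _ _ _ ⟨
      h + ∑< k old + w * ∑< k new ∎
      where
      w = step⁻ (suc b) k
      t = T (suc k) s q
      h = 1# * multichoose (q ^ 2) b 0 * t
      f old new : ℕ → Carrier
      f   i = Q (headExponent (suc b) (suc k) (suc i)) * multichoose (q ^ 2) (suc b) (suc i)
                * T (k ℕ.∸ i) s q
      old i = Q (headExponent b (suc k) (suc i)) * multichoose (q ^ 2) b (suc i) * T (k ℕ.∸ i) s q
      new i = Q (headExponent (suc b) k i) * multichoose (q ^ 2) (suc b) i * T (k ℕ.∸ i) s q

      Q-old : ∀ i → Q (headExponent b (suc k) (suc i))
                  ≈ Q (headExponent (suc b) (suc k) (suc i)) * Q (+ 2 ℤ.* + suc i)
      Q-old i = Q-split (headExponent (suc b) (suc k) (suc i)) (+ 2 ℤ.* + suc i)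
        (IntExponents.head-b (+ b) (+ k) (+ i))

      Q-new : ∀ i → Q (headExponent (suc b) (suc k) (suc i)) ≈ w * Q (headExponent (suc b) k i)
      Q-new i = Q-split (+ 2 ℤ.* + k ℤ.+ + 3 ℤ.- + 2 ℤ.* + suc b) (headExponent (suc b) k i)
        (IntExponents.head-k (+ suc b) (+ k) (+ i))

      term : ∀ i → f i ≈ old i + w * new i
      term i = begin
        x * multichoose (q ^ 2) (suc b) (suc i) * u
          ≈⟨ *-congʳ (*-congˡ (multichoose-suc (q ^ 2) b i)) ⟩
        x * (multichoose (q ^ 2) (suc b) i + (q ^ 2) ^ suc i * multichoose (q ^ 2) b (suc i)) * u
          ≈⟨ solve 5 (λ x g y h u → x :* (g :+ y :* h) :* u
                                 := x :* y :* h :* u :+ x :* g :* u) refl _ _ _ _ _ ⟩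
        x * (q ^ 2) ^ suc i * multichoose (q ^ 2) b (suc i) * u + x * multichoose (q ^ 2) (suc b) i * u
          ≈⟨ +-cong (*-congʳ (*-congʳ (trans (*-congˡ ([q²]^ (suc i))) (sym (Q-old i)))))
                    (*-congʳ (*-congʳ (Q-new i))) ⟩
        old i + w * Q (headExponent (suc b) k i) * multichoose (q ^ 2) (suc b) i * u
          ≈⟨ +-congˡ (solve 4 (λ w x g u → w :* x :* g :* u := w :* (x :* g :* u)) refl _ _ _ _) ⟩
        old i + w * new i ∎
        where
        x = Q (headExponent (suc b) (suc k) (suc i))
        u = T (k ℕ.∸ i) s q

    -- Here the mirror rule is needed: its weight q^(2k) turns the q^(2(i+1)) of term i+1 into
    -- q^(2(k+1)) q^(2i), and `pochhammer-base` supplies the factor 1 - s q^(-b). Both factors are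
    -- independent of i.
    tailSum⁻-suc : ∀ s b k → tailSum⁻ s (suc b) (suc k)
      ≈ tailSum⁻ s (suc b) k + (1# - base s (suc b)) * q ^ (2 ℕ.* suc k) * tailSum⁻ s b (suc k)
    tailSum⁻-suc s b k = begin
      1# * 1# * 1# + ∑< b f
        ≈⟨ +-cong (*-congˡ (sym (multichoose-0 (q ^ 2) k))) (∑-cong b term) ⟩
      h + ∑[ i < b ] (old i + w * new i)
        ≈⟨ +-congˡ (trans (∑-+ b old (λ i → w * new i)) (+-congˡ (∑-*ˡ b w new))) ⟩
      h + (∑< b old + w * ∑< b new)
        ≈⟨ +-assoc _ _ _ ⟨
      h + ∑< b old + w * ∑< b new ∎
      where
      w = (1# - base s (suc b)) * q ^ (2 ℕ.* suc k)
      h = 1# * 1# * multichoose (q ^ 2) k 0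
      f old new : ℕ → Carrier
      f   i = ⟨ base s (suc b) ⨾ q ⟩ (suc i) * q ^ (2 ℕ.* suc i) * multichoose (q ^ 2) (suc k) (suc i)
      old i = ⟨ base s (suc b) ⨾ q ⟩ (suc i) * q ^ (2 ℕ.* suc i) * multichoose (q ^ 2) k (suc i)
      new i = ⟨ base s b ⨾ q ⟩ i * q ^ (2 ℕ.* i) * multichoose (q ^ 2) (suc k) i

      q²p²≈1 : q ^ 2 * p ^ 2 ≈ 1#
      q²p²≈1 = begin
        q ^ 2 * p ^ 2    ≈⟨ solve 2 (λ q p → q :^ 2 :* p :^ 2 := q :* p :* (q :* p)) refl q p ⟩
        q * p * (q * p)  ≈⟨ *-cong qp≈1 qp≈1 ⟩
        1# * 1#          ≈⟨ *-identityˡ _ ⟩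
        1#               ∎

      q^ : ∀ i → q ^ (2 ℕ.* suc i) * (q ^ 2) ^ k ≈ q ^ (2 ℕ.* suc k) * q ^ (2 ℕ.* i)
      q^ i = begin
        q ^ (2 ℕ.* suc i) * (q ^ 2) ^ k          ≈⟨ *-congˡ (^-assocʳ q 2 k) ⟩
        q ^ (2 ℕ.* suc i) * q ^ (2 ℕ.* k)        ≈⟨ ^-homo-* q (2 ℕ.* suc i) (2 ℕ.* k) ⟨
        q ^ (2 ℕ.* suc i ℕ.+ 2 ℕ.* k)
          ≈⟨ ^-split q (2 ℕ.* suc k) (2 ℕ.* i) (NatExponents.even i k) ⟩
        q ^ (2 ℕ.* suc k) * q ^ (2 ℕ.* i)        ∎

      term : ∀ i → f i ≈ old i + w * new i
      term i = begin
        x * y * multichoose (q ^ 2) (suc k) (suc i)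
          ≈⟨ *-congˡ (multichoose-suc′ q²p²≈1 k i) ⟩
        x * y * (multichoose (q ^ 2) k (suc i) + (q ^ 2) ^ k * g)
          ≈⟨ solve 5 (λ x y h z g → x :* y :* (h :+ z :* g)
                                 := x :* y :* h :+ x :* (y :* z) :* g) refl _ _ _ _ _ ⟩
        old i + x * (y * (q ^ 2) ^ k) * g
          ≈⟨ +-congˡ (*-congʳ (*-cong (pochhammer-base s b i) (q^ i))) ⟩
        old i + (1# - base s (suc b)) * ⟨ base s b ⨾ q ⟩ i * (q ^ (2 ℕ.* suc k) * q ^ (2 ℕ.* i)) * g
          ≈⟨ +-congˡ (solve 5 (λ a c x y g → a :* c :* (x :* y) :* g
                                          := a :* x :* (c :* y :* g)) refl _ _ _ _ _) ⟩
        old i + w * new i ∎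
        where
        x = ⟨ base s (suc b) ⨾ q ⟩ (suc i)
        y = q ^ (2 ℕ.* suc i)
        g = multichoose (q ^ 2) (suc k) i

    -- At b = k = 0 both sums are empty although T_0 = 1, so the corner is excluded. The rest of the
    -- edges b = 0 and k = 0 starts the induction, which lowers either b or k.
    T-negative : ∀ {s} → s * s ≈ 1# → ∀ b k → 1 ℕ.≤ b ⊎ 1 ℕ.≤ k →
      T k (s * p ^ b) q ≈ ⟨ base s b ⨾ q ⟩ b * headSum⁻ s b k + Q (tailExponent b k) * tailSum⁻ s b k
    T-negative _ zero zero (inj₁ ())
    T-negative _ zero zero (inj₂ ())
    T-negative {s} _ zero (suc k) _ = begin
      T (suc k) (s * 1#) q
        ≈⟨ T-cong (suc k) q (*-identityʳ s) ⟩
      T (suc k) s q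
        ≈⟨ solve 2 (λ t x → t := con 1ℤ :* (con 1ℤ :* con 1ℤ :* t :+ con 0ℤ) :+ x :* con 0ℤ) refl _ x ⟩
      1# * (1# * 1# * T (suc k) s q + 0#) + x * 0#
        ≈⟨ +-congʳ (*-congˡ (+-congˡ (trans
             (∑-cong k {λ i → Q (headExponent 0 (suc k) (suc i)) * 0# * T (k ℕ.∸ i) s q}
               λ i → trans (*-congʳ (zeroʳ _)) (zeroˡ _)) (∑-zero k)))) ⟨
      1# * headSum⁻ s 0 (suc k) + x * 0# ∎
      where x = Q (tailExponent 0 (suc k))
    T-negative {s} _ (suc b) zero _ = begin
      1#
        ≈⟨ solve 1 (λ x → con 1ℤ
             := x :* con 0ℤ :+ con 1ℤ :* (con 1ℤ :* con 1ℤ :* con 1ℤ :+ con 0ℤ)) refl x ⟩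
      x * 0# + 1# * (1# * 1# * 1# + 0#)
        ≈⟨ +-congˡ (*-congˡ (+-congˡ (trans
             (∑-cong b {λ i → ⟨ base s (suc b) ⨾ q ⟩ (suc i) * q ^ (2 ℕ.* suc i) * 0#} λ i → zeroʳ _)
             (∑-zero b)))) ⟨
      x * 0# + 1# * tailSum⁻ s (suc b) 0 ∎
      where x = ⟨ base s (suc b) ⨾ q ⟩ (suc b)
    T-negative {s} s²≈1 (suc b) (suc k) _ = begin
      T (suc k) t q
        -- Since -w = t² q^(2k+3), subtracting w T_k(t) produces the right-hand side of `T-descent`,
        -- which is then read backwards.
        ≈⟨ solve 2 (λ a x → a := a :+ (:- x) :+ x) refl _ (w * T k t q) ⟩
      T (suc k) t q + - (w * T k t q) + w * T k t q
        ≈⟨ +-congʳ (+-congˡ (solve 2 (λ x y → :- (x :* y) := (:- x) :* y) refl _ _)) ⟩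
      T (suc k) t q + - w * T k t q + w * T k t q
        ≈⟨ +-congʳ (+-congˡ (*-congʳ t²q^)) ⟨
      T (suc k) t q + t ^ 2 * q ^ suc (2 ℕ.* suc k) * T k t q + w * T k t q
        ≈⟨ +-congʳ (T-descent k t q) ⟨
      (1# - t * q) * T (suc k) (t * q) q + w * T k t q
        ≈⟨ +-congʳ (*-cong (+-congˡ (-‿cong (*-assoc s _ q))) (T-cong (suc k) q tq)) ⟩
      (1# - a) * T (suc k) (s * p ^ b) q + w * T k t q
        ≈⟨ +-cong (*-congˡ (T-negative s²≈1 b (suc k) (inj₂ (s≤s z≤n))))
                  (*-congˡ (T-negative s²≈1 (suc b) k (inj₁ (s≤s z≤n)))) ⟩
      (1# - a) * (P * headSum⁻ s b (suc k) + Q (tailExponent b (suc k)) * tailSum⁻ s b (suc k))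
        + w * (P′ * headSum⁻ s (suc b) k + Q (tailExponent (suc b) k) * tailSum⁻ s (suc b) k)
        ≈⟨ +-congʳ (*-congˡ (+-congˡ (*-congʳ Q-b))) ⟩
      (1# - a) * (P * headSum⁻ s b (suc k) + x * y * tailSum⁻ s b (suc k))
        + w * (P′ * headSum⁻ s (suc b) k + Q (tailExponent (suc b) k) * tailSum⁻ s (suc b) k)
        ≈⟨ solve 11 (λ a p h x y t w p′ h′ z t′ →
              (con 1ℤ :- a) :* (p :* h :+ x :* y :* t) :+ w :* (p′ :* h′ :+ z :* t′)
              := (con 1ℤ :- a) :* p :* h :+ p′ :* (w :* h′)
                :+ (w :* z :* t′ :+ x :* ((con 1ℤ :- a) :* y :* t))) refl
              a P (headSum⁻ s b (suc k)) x y (tailSum⁻ s b (suc k)) w P′ (headSum⁻ s (suc b) k)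
              (Q (tailExponent (suc b) k)) (tailSum⁻ s (suc b) k) ⟩
      (1# - a) * P * headSum⁻ s b (suc k) + P′ * (w * headSum⁻ s (suc b) k)
        + (w * Q (tailExponent (suc b) k) * tailSum⁻ s (suc b) k
            + x * ((1# - a) * y * tailSum⁻ s b (suc k)))
        ≈⟨ +-cong (+-congʳ (*-congʳ (pochhammer-base s b b))) (+-congʳ (*-congʳ Q-k)) ⟨
      P′ * headSum⁻ s b (suc k) + P′ * (w * headSum⁻ s (suc b) k)
        + (x * tailSum⁻ s (suc b) k + x * ((1# - a) * y * tailSum⁻ s b (suc k)))
        ≈⟨ +-cong (distribˡ P′ _ _) (distribˡ x _ _) ⟨
      P′ * (headSum⁻ s b (suc k) + w * headSum⁻ s (suc b) k)
        + x * (tailSum⁻ s (suc b) k + (1# - a) * y * tailSum⁻ s b (suc k))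
        ≈⟨ +-cong (*-congˡ (headSum⁻-suc s b k)) (*-congˡ (tailSum⁻-suc s b k)) ⟨
      P′ * headSum⁻ s (suc b) (suc k) + x * tailSum⁻ s (suc b) (suc k) ∎
      where
      t = s * p ^ suc b
      a = base s (suc b)
      w = step⁻ (suc b) k
      P = ⟨ base s b ⨾ q ⟩ b
      P′ = ⟨ base s (suc b) ⨾ q ⟩ (suc b)
      x = Q (tailExponent (suc b) (suc k))
      y = q ^ (2 ℕ.* suc k)

      tq : t * q ≈ s * p ^ b
      tq = begin
        s * (p * p ^ b) * q  ≈⟨ solve 4 (λ s p y q → s :* (p :* y) :* q := q :* p :* (s :* y)) refl _ _ _ _ ⟩
        q * p * (s * p ^ b)  ≈⟨ *-congʳ qp≈1 ⟩
        1# * (s * p ^ b)     ≈⟨ *-identityˡ _ ⟩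
        s * p ^ b            ∎

      t²q^ : t ^ 2 * q ^ suc (2 ℕ.* suc k) ≈ - w
      t²q^ = begin
        (s * p ^ suc b) ^ 2 * (q * q ^ (2 ℕ.* suc k))
          ≈⟨ solve 4 (λ s x q y → (s :* x) :^ 2 :* (q :* y)
                 := s :* s :* (:- ((:- q) :* con 1ℤ :* x :^ 2 :* y)))
               refl s (p ^ suc b) q _ ⟩
        s * s * - (Q 1ℤ * (p ^ suc b) ^ 2 * q ^ (2 ℕ.* suc k))
          ≈⟨ *-cong s²≈1 (-‿cong (*-cong (*-congˡ p^) (q^2* (suc k)))) ⟩
        1# * - (Q 1ℤ * Q (ℤ.- (+ 2 ℤ.* + suc b)) * Q (+ 2 ℤ.* + suc k))
          ≈⟨ trans (*-identityˡ _) (-‿cong (sym Q-w)) ⟩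
        - w ∎
        where
        p^ : (p ^ suc b) ^ 2 ≈ Q (ℤ.- (+ 2 ℤ.* + suc b))
        p^ = trans (^-assocʳ p (suc b) 2) (trans (^-≡ p (ℕ.*-comm (suc b) 2)) (p^2* (suc b)))
        Q-w : w ≈ Q 1ℤ * Q (ℤ.- (+ 2 ℤ.* + suc b)) * Q (+ 2 ℤ.* + suc k)
        Q-w = trans
          (Q-split (1ℤ ℤ.+ ℤ.- (+ 2 ℤ.* + suc b)) (+ 2 ℤ.* + suc k)
            (IntExponents.descent (+ suc b) (+ k)))
          (*-congʳ (Q-split 1ℤ (ℤ.- (+ 2 ℤ.* + suc b)) ≡.refl))

      Q-b : Q (tailExponent b (suc k)) ≈ x * y
      Q-b = trans
        (Q-split (tailExponent (suc b) (suc k)) (+ 2 ℤ.* + suc k)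
          (IntExponents.tail-b (+ b) (+ suc k)))
        (*-congˡ (sym (q^2* (suc k))))

      Q-k : x ≈ w * Q (tailExponent (suc b) k)
      Q-k = Q-split (+ 2 ℤ.* + k ℤ.+ + 3 ℤ.- + 2 ℤ.* + suc b) (tailExponent (suc b) k)
        (IntExponents.tail-k (+ suc b) (+ k))

-- The polynomials over ℤ form a commutative ring.

module Polynomials where
  open Defs hiding (_+_; _*_; -_; _-_; _≈_)
  open import Relation.Binary.PropositionalEquality
  open ≡-Reasoning

  coeff--ₚ : ∀ p n → coeff (-ₚ p) n ≡ ℤ.- coeff p n
  coeff--ₚ []      n       = refl
  coeff--ₚ (a ∷ p) zero    = refl
  coeff--ₚ (a ∷ p) (suc n) = coeff--ₚ p n

  +ₚ-cong : ∀ p p′ r r′ → p ≈ₚ p′ → r ≈ₚ r′ → p +ₚ r ≈ₚ p′ +ₚ r′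
  +ₚ-cong p p′ r r′ p≈ r≈ n = begin
    coeff (p +ₚ r) n              ≡⟨ coeff-+ₚ p r n ⟩
    coeff p n ℤ.+ coeff r n       ≡⟨ cong₂ ℤ._+_ (p≈ n) (r≈ n) ⟩
    coeff p′ n ℤ.+ coeff r′ n     ≡⟨ coeff-+ₚ p′ r′ n ⟨
    coeff (p′ +ₚ r′) n            ∎

  +ₚ-assoc : ∀ p r s → (p +ₚ r) +ₚ s ≈ₚ p +ₚ (r +ₚ s)
  +ₚ-assoc p r s n = begin
    coeff ((p +ₚ r) +ₚ s) n                       ≡⟨ coeff-+ₚ (p +ₚ r) s n ⟩
    coeff (p +ₚ r) n ℤ.+ coeff s n                ≡⟨ cong (ℤ._+ coeff s n) (coeff-+ₚ p r n) ⟩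
    coeff p n ℤ.+ coeff r n ℤ.+ coeff s n         ≡⟨ ℤ.+-assoc (coeff p n) _ _ ⟩
    coeff p n ℤ.+ (coeff r n ℤ.+ coeff s n)       ≡⟨ cong (λ c → coeff p n ℤ.+ c) (coeff-+ₚ r s n) ⟨
    coeff p n ℤ.+ coeff (r +ₚ s) n                ≡⟨ coeff-+ₚ p (r +ₚ s) n ⟨
    coeff (p +ₚ (r +ₚ s)) n                       ∎

  +ₚ-comm : ∀ p r → p +ₚ r ≈ₚ r +ₚ p
  +ₚ-comm p r n = begin
    coeff (p +ₚ r) n            ≡⟨ coeff-+ₚ p r n ⟩
    coeff p n ℤ.+ coeff r n     ≡⟨ ℤ.+-comm (coeff p n) _ ⟩
    coeff r n ℤ.+ coeff p n     ≡⟨ coeff-+ₚ r p n ⟨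
    coeff (r +ₚ p) n            ∎

  +ₚ-identityʳ : ∀ p → p +ₚ 0ₚ ≈ₚ p
  +ₚ-identityʳ p n = trans (coeff-+ₚ p [] n) (ℤ.+-identityʳ _)

  -ₚ-cong : ∀ {p r} → p ≈ₚ r → -ₚ p ≈ₚ -ₚ r
  -ₚ-cong {p} {r} p≈r n =
    trans (coeff--ₚ p n) (trans (cong ℤ.-_ (p≈r n)) (sym (coeff--ₚ r n)))

  -ₚ-inverseʳ : ∀ p → p +ₚ -ₚ p ≈ₚ 0ₚ
  -ₚ-inverseʳ p n = begin
    coeff (p +ₚ -ₚ p) n              ≡⟨ coeff-+ₚ p (-ₚ p) n ⟩
    coeff p n ℤ.+ coeff (-ₚ p) n     ≡⟨ cong (λ c → coeff p n ℤ.+ c) (coeff--ₚ p n) ⟩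
    coeff p n ℤ.- coeff p n          ≡⟨ ℤ.+-inverseʳ (coeff p n) ⟩
    0ℤ                               ∎

  shift-cong : ∀ p r → p ≈ₚ r → 0ℤ ∷ p ≈ₚ 0ℤ ∷ r
  shift-cong p r p≈r zero    = refl
  shift-cong p r p≈r (suc n) = p≈r n

  *ₚ-congˡ : ∀ p {r s} → r ≈ₚ s → p *ₚ r ≈ₚ p *ₚ s
  *ₚ-congˡ []      r≈s n = refl
  *ₚ-congˡ (a ∷ p) {r} {s} r≈s n = begin
    coeff ((a ∷ p) *ₚ r) n                        ≡⟨ coeff-*ₚ a p r n ⟩
    a ℤ.* coeff r n ℤ.+ coeff (0ℤ ∷ p *ₚ r) n     ≡⟨ cong₂ (λ c d → a ℤ.* c ℤ.+ d) (r≈s n)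
                                                       (shift-cong (p *ₚ r) (p *ₚ s) (*ₚ-congˡ p r≈s) n) ⟩
    a ℤ.* coeff s n ℤ.+ coeff (0ℤ ∷ p *ₚ s) n     ≡⟨ coeff-*ₚ a p s n ⟨
    coeff ((a ∷ p) *ₚ s) n                        ∎

  *ₚ-zeroʳ : ∀ p → p *ₚ 0ₚ ≈ₚ 0ₚ
  *ₚ-zeroʳ []      n       = refl
  *ₚ-zeroʳ (a ∷ p) zero    = refl
  *ₚ-zeroʳ (a ∷ p) (suc n) = *ₚ-zeroʳ p n

  swap : ∀ x y z → x ℤ.+ (y ℤ.+ z) ≡ y ℤ.+ (x ℤ.+ z)
  swap = ℤ-Solver.solve-∀

  -- Multiplication is defined by recursion on the left factor; this is the matching recursion on
  -- the right factor, and commutativity follows by comparing the two.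
  *ₚ-∷ : ∀ p b r → p *ₚ (b ∷ r) ≈ₚ map (b ℤ.*_) p +ₚ (0ℤ ∷ p *ₚ r)
  *ₚ-∷ []      b r zero    = refl
  *ₚ-∷ []      b r (suc n) = refl
  *ₚ-∷ (a ∷ p) b r zero    = cong (ℤ._+ 0ℤ) (ℤ.*-comm a b)
  *ₚ-∷ (a ∷ p) b r (suc n) = begin
    coeff ((a ∷ p) *ₚ (b ∷ r)) (suc n)
      ≡⟨ coeff-*ₚ a p (b ∷ r) (suc n) ⟩
    a ℤ.* coeff r n ℤ.+ coeff (p *ₚ (b ∷ r)) n
      ≡⟨ cong (λ c → a ℤ.* coeff r n ℤ.+ c)
           (trans (*ₚ-∷ p b r n) (coeff-+ₚ (map (b ℤ.*_) p) (0ℤ ∷ p *ₚ r) n)) ⟩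
    a ℤ.* coeff r n ℤ.+ (coeff (map (b ℤ.*_) p) n ℤ.+ coeff (0ℤ ∷ p *ₚ r) n)
      ≡⟨ swap
           (a ℤ.* coeff r n) (coeff (map (b ℤ.*_) p) n) _ ⟩
    coeff (map (b ℤ.*_) p) n ℤ.+ (a ℤ.* coeff r n ℤ.+ coeff (0ℤ ∷ p *ₚ r) n)
      ≡⟨ cong (λ c → coeff (map (b ℤ.*_) p) n ℤ.+ c) (coeff-*ₚ a p r n) ⟨
    coeff (map (b ℤ.*_) p) n ℤ.+ coeff ((a ∷ p) *ₚ r) n
      ≡⟨ coeff-+ₚ (map (b ℤ.*_) p) ((a ∷ p) *ₚ r) n ⟨
    coeff (map (b ℤ.*_) p +ₚ ((a ∷ p) *ₚ r)) n ∎

  *ₚ-comm : ∀ p r → p *ₚ r ≈ₚ r *ₚ p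
  *ₚ-comm []      r n = sym (*ₚ-zeroʳ r n)
  *ₚ-comm (a ∷ p) r n = begin
    coeff (map (a ℤ.*_) r +ₚ (0ℤ ∷ p *ₚ r)) n
      ≡⟨ +ₚ-cong (map (a ℤ.*_) r) (map (a ℤ.*_) r) (0ℤ ∷ p *ₚ r) (0ℤ ∷ r *ₚ p) (λ _ → refl)
           (shift-cong (p *ₚ r) (r *ₚ p) (*ₚ-comm p r)) n ⟩
    coeff (map (a ℤ.*_) r +ₚ (0ℤ ∷ r *ₚ p)) n
      ≡⟨ *ₚ-∷ r a p n ⟨
    coeff (r *ₚ (a ∷ p)) n ∎

  *ₚ-congʳ : ∀ s {p r} → p ≈ₚ r → p *ₚ s ≈ₚ r *ₚ s
  *ₚ-congʳ s {p} {r} p≈r n =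
    trans (*ₚ-comm p s n) (trans (*ₚ-congˡ s p≈r n) (*ₚ-comm s r n))

  shift-+ₚ : ∀ p r n → coeff (0ℤ ∷ p +ₚ r) n ≡ coeff (0ℤ ∷ p) n ℤ.+ coeff (0ℤ ∷ r) n
  shift-+ₚ p r zero    = refl
  shift-+ₚ p r (suc n) = coeff-+ₚ p r n

  distrib-interchange : ∀ a x y z w →
    a ℤ.* (x ℤ.+ y) ℤ.+ (z ℤ.+ w) ≡ (a ℤ.* x ℤ.+ z) ℤ.+ (a ℤ.* y ℤ.+ w)
  distrib-interchange = ℤ-Solver.solve-∀

  *ₚ-distribˡ-+ₚ : ∀ p r s → p *ₚ (r +ₚ s) ≈ₚ p *ₚ r +ₚ p *ₚ s
  *ₚ-distribˡ-+ₚ []      r s n = refl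
  *ₚ-distribˡ-+ₚ (a ∷ p) r s n = begin
    coeff ((a ∷ p) *ₚ (r +ₚ s)) n
      ≡⟨ coeff-*ₚ a p (r +ₚ s) n ⟩
    a ℤ.* coeff (r +ₚ s) n ℤ.+ coeff (0ℤ ∷ p *ₚ (r +ₚ s)) n
      ≡⟨ cong₂ (λ c d → a ℤ.* c ℤ.+ d) (coeff-+ₚ r s n)
           (trans (shift-cong (p *ₚ (r +ₚ s)) (p *ₚ r +ₚ p *ₚ s) (*ₚ-distribˡ-+ₚ p r s) n) (shift-+ₚ (p *ₚ r) (p *ₚ s) n)) ⟩
    a ℤ.* (coeff r n ℤ.+ coeff s n) ℤ.+ (coeff (0ℤ ∷ p *ₚ r) n ℤ.+ coeff (0ℤ ∷ p *ₚ s) n)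
      ≡⟨ distrib-interchange
           a (coeff r n) (coeff s n) _ _ ⟩
    (a ℤ.* coeff r n ℤ.+ coeff (0ℤ ∷ p *ₚ r) n) ℤ.+ (a ℤ.* coeff s n ℤ.+ coeff (0ℤ ∷ p *ₚ s) n)
      ≡⟨ cong₂ ℤ._+_ (coeff-*ₚ a p r n) (coeff-*ₚ a p s n) ⟨
    coeff ((a ∷ p) *ₚ r) n ℤ.+ coeff ((a ∷ p) *ₚ s) n
      ≡⟨ coeff-+ₚ ((a ∷ p) *ₚ r) ((a ∷ p) *ₚ s) n ⟨
    coeff ((a ∷ p) *ₚ r +ₚ (a ∷ p) *ₚ s) n ∎

  *ₚ-distribʳ-+ₚ : ∀ s p r → (p +ₚ r) *ₚ s ≈ₚ p *ₚ s +ₚ r *ₚ s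
  *ₚ-distribʳ-+ₚ s p r n = begin
    coeff ((p +ₚ r) *ₚ s) n              ≡⟨ *ₚ-comm (p +ₚ r) s n ⟩
    coeff (s *ₚ (p +ₚ r)) n              ≡⟨ *ₚ-distribˡ-+ₚ s p r n ⟩
    coeff (s *ₚ p +ₚ s *ₚ r) n           ≡⟨ +ₚ-cong (s *ₚ p) (p *ₚ s) (s *ₚ r) (r *ₚ s) (*ₚ-comm s p) (*ₚ-comm s r) n ⟩
    coeff (p *ₚ s +ₚ r *ₚ s) n           ∎

  scale-*ₚ : ∀ a r s → map (a ℤ.*_) r *ₚ s ≈ₚ map (a ℤ.*_) (r *ₚ s)
  scale-*ₚ a []      s n = refl
  scale-*ₚ a (b ∷ r) s n = begin
    coeff ((a ℤ.* b ∷ map (a ℤ.*_) r) *ₚ s) n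
      ≡⟨ coeff-*ₚ (a ℤ.* b) (map (a ℤ.*_) r) s n ⟩
    a ℤ.* b ℤ.* coeff s n ℤ.+ coeff (0ℤ ∷ map (a ℤ.*_) r *ₚ s) n
      ≡⟨ cong₂ ℤ._+_ (ℤ.*-assoc a b _) (shifted n) ⟩
    a ℤ.* (b ℤ.* coeff s n) ℤ.+ a ℤ.* coeff (0ℤ ∷ r *ₚ s) n
      ≡⟨ ℤ.*-distribˡ-+ a (b ℤ.* coeff s n) _ ⟨
    a ℤ.* (b ℤ.* coeff s n ℤ.+ coeff (0ℤ ∷ r *ₚ s) n)
      ≡⟨ cong (a ℤ.*_) (coeff-*ₚ b r s n) ⟨
    a ℤ.* coeff ((b ∷ r) *ₚ s) n
      ≡⟨ coeff-scale a ((b ∷ r) *ₚ s) n ⟨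
    coeff (map (a ℤ.*_) ((b ∷ r) *ₚ s)) n ∎
    where
    shifted : ∀ n → coeff (0ℤ ∷ map (a ℤ.*_) r *ₚ s) n ≡ a ℤ.* coeff (0ℤ ∷ r *ₚ s) n
    shifted zero    = sym (ℤ.*-zeroʳ a)
    shifted (suc n) = trans (scale-*ₚ a r s n) (coeff-scale a (r *ₚ s) n)

  shift-*ₚ : ∀ p r → (0ℤ ∷ p) *ₚ r ≈ₚ 0ℤ ∷ p *ₚ r
  shift-*ₚ p r n = trans (coeff-*ₚ 0ℤ p r n) (ℤ.+-identityˡ _)

  *ₚ-assoc : ∀ p r s → (p *ₚ r) *ₚ s ≈ₚ p *ₚ (r *ₚ s)
  *ₚ-assoc []      r s n = refl
  *ₚ-assoc (a ∷ p) r s n = begin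
    coeff ((map (a ℤ.*_) r +ₚ (0ℤ ∷ p *ₚ r)) *ₚ s) n
      ≡⟨ *ₚ-distribʳ-+ₚ s (map (a ℤ.*_) r) (0ℤ ∷ p *ₚ r) n ⟩
    coeff (map (a ℤ.*_) r *ₚ s +ₚ (0ℤ ∷ p *ₚ r) *ₚ s) n
      ≡⟨ +ₚ-cong (map (a ℤ.*_) r *ₚ s) (map (a ℤ.*_) (r *ₚ s))
           ((0ℤ ∷ p *ₚ r) *ₚ s) (0ℤ ∷ p *ₚ (r *ₚ s)) (scale-*ₚ a r s)
           (λ m → trans (shift-*ₚ (p *ₚ r) s m)
                        (shift-cong ((p *ₚ r) *ₚ s) (p *ₚ (r *ₚ s)) (*ₚ-assoc p r s) m)) n ⟩
    coeff (map (a ℤ.*_) (r *ₚ s) +ₚ (0ℤ ∷ p *ₚ (r *ₚ s))) n ∎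

  *ₚ-identityˡ : ∀ p → 1ₚ *ₚ p ≈ₚ p
  *ₚ-identityˡ p n = begin
    coeff (1ₚ *ₚ p) n                          ≡⟨ coeff-*ₚ 1ℤ [] p n ⟩
    1ℤ ℤ.* coeff p n ℤ.+ coeff (0ℤ ∷ []) n     ≡⟨ cong₂ ℤ._+_ (ℤ.*-identityˡ (coeff p n)) (0∷[] n) ⟩
    coeff p n ℤ.+ 0ℤ                           ≡⟨ ℤ.+-identityʳ _ ⟩
    coeff p n                                  ∎
    where
    0∷[] : ∀ n → coeff (0ℤ ∷ []) n ≡ 0ℤ
    0∷[] zero    = refl
    0∷[] (suc n) = refl

  polyRing : CommutativeRing 0ℓ 0ℓ
  polyRing = record
    { Carrier = Poly
    ; _≈_ = _≈ₚ_
    ; _+_ = _+ₚ_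
    ; _*_ = _*ₚ_
    ; -_ = -ₚ_
    ; 0# = 0ₚ
    ; 1# = 1ₚ
    ; isCommutativeRing = record
      { isRing = record
        { +-isAbelianGroup = record
          { isGroup = record
            { isMonoid = record
              { isSemigroup = record
                { isMagma = record
                  { isEquivalence = record
                    { refl  = λ n → refl
                    ; sym   = λ e n → sym (e n)
                    ; trans = λ e f n → trans (e n) (f n)
                    }
                  ; ∙-cong = λ {p} {p′} {r} {r′} → +ₚ-cong p p′ r r′
                  }
                ; assoc = +ₚ-assoc
                }
              ; identity = (λ p n → refl) , +ₚ-identityʳ
              }
            ; inverse = (λ p n → trans (+ₚ-comm (-ₚ p) p n) (-ₚ-inverseʳ p n)) , -ₚ-inverseʳ
            ; ⁻¹-cong = λ {p} {r} → -ₚ-cong {p} {r}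
            }
          ; comm = +ₚ-comm
          }
        ; *-cong = λ {p} {p′} {r} {r′} p≈ r≈ n →
            trans (*ₚ-congʳ r {p} {p′} p≈ n) (*ₚ-congˡ p′ {r} {r′} r≈ n)
        ; *-assoc = *ₚ-assoc
        ; *-identity = *ₚ-identityˡ , λ p n → trans (*ₚ-comm p 1ₚ n) (*ₚ-identityˡ p n)
        ; distrib = *ₚ-distribˡ-+ₚ , *ₚ-distribʳ-+ₚ
        }
      ; *-comm = *ₚ-comm
      }
    }

-- The laws of fractions, cross-multiplied.

module FractionIdentities {c ℓ} (R : CommutativeRing c ℓ) where
  open CommutativeRing R hiding (_-_; zero; +-assoc; +-comm; +-identityˡ; +-cong; -‿cong;
                                    *-assoc; *-comm; *-identityˡ; *-cong)
  private module R = CommutativeRing R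
  open IntegerSolver R
  open Relation.Binary.Reasoning.Setoid setoid

  difference-0 : ∀ a b d → a * d ≈ b * d → (a + - b) * d ≈ 0#
  difference-0 a b d ad≈bd = begin
    (a + - b) * d      ≈⟨ solve 3 (λ a b d → (a :- b) :* d := a :* d :- b :* d) refl a b d ⟩
    a * d + - (b * d)  ≈⟨ R.+-congʳ ad≈bd ⟩
    b * d + - (b * d)  ≈⟨ -‿inverseʳ _ ⟩
    0#                 ∎

  from-difference-0 : ∀ a b → a + - b ≈ 0# → a ≈ b
  from-difference-0 a b a-b≈0 = begin
    a            ≈⟨ solve 2 (λ a b → a := a :- b :+ b) refl a b ⟩
    a + - b + b  ≈⟨ R.+-congʳ a-b≈0 ⟩
    0# + b       ≈⟨ R.+-identityˡ b ⟩
    b            ∎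

  -- Transitivity of equality of fractions up to the middle denominator `d`, whose cancellation
  -- needs an integral domain and is left to `*ₚ-cancelʳ`.
  cross-trans : ∀ a b c d e f → a * d ≈ c * b → c * f ≈ e * d → a * f * d ≈ e * b * d
  cross-trans a b c d e f ad≈cb cf≈ed = begin
    a * f * d    ≈⟨ solve 3 (λ a d f → a :* f :* d := a :* d :* f) refl a d f ⟩
    a * d * f    ≈⟨ *-congʳ ad≈cb ⟩
    c * b * f    ≈⟨ solve 3 (λ b c f → c :* b :* f := c :* f :* b) refl b c f ⟩
    c * f * b    ≈⟨ *-congʳ cf≈ed ⟩
    e * d * b    ≈⟨ solve 3 (λ b d e → e :* d :* b := e :* b :* d) refl b d e ⟩
    e * b * d    ∎

  +-cong : ∀ a b a′ b′ c d c′ d′ → a * b′ ≈ a′ * b → c * d′ ≈ c′ * d →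
    (a * d + c * b) * (b′ * d′) ≈ (a′ * d′ + c′ * b′) * (b * d)
  +-cong a b a′ b′ c d c′ d′ e₁ e₂ = begin
    (a * d + c * b) * (b′ * d′)
      ≈⟨ solve 6 (λ a b b′ c d d′ → (a :* d :+ c :* b) :* (b′ :* d′)
           := a :* b′ :* (d :* d′) :+ c :* d′ :* (b :* b′)) refl a b b′ c d d′ ⟩
    a * b′ * (d * d′) + c * d′ * (b * b′)
      ≈⟨ R.+-cong (*-congʳ e₁) (*-congʳ e₂) ⟩
    a′ * b * (d * d′) + c′ * d * (b * b′)
      ≈⟨ solve 6 (λ a′ b b′ c′ d d′ → a′ :* b :* (d :* d′) :+ c′ :* d :* (b :* b′)
           := (a′ :* d′ :+ c′ :* b′) :* (b :* d)) refl a′ b b′ c′ d d′ ⟩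
    (a′ * d′ + c′ * b′) * (b * d) ∎

  *-cong : ∀ a b a′ b′ c d c′ d′ → a * b′ ≈ a′ * b → c * d′ ≈ c′ * d →
    a * c * (b′ * d′) ≈ a′ * c′ * (b * d)
  *-cong a b a′ b′ c d c′ d′ e₁ e₂ = begin
    a * c * (b′ * d′)
      ≈⟨ solve 4 (λ a b′ c d′ → a :* c :* (b′ :* d′) := a :* b′ :* (c :* d′)) refl a b′ c d′ ⟩
    a * b′ * (c * d′)    ≈⟨ R.*-cong e₁ e₂ ⟩
    a′ * b * (c′ * d)
      ≈⟨ solve 4 (λ a′ b c′ d → a′ :* b :* (c′ :* d) := a′ :* c′ :* (b :* d)) refl a′ b c′ d ⟩
    a′ * c′ * (b * d)    ∎

  -‿cong : ∀ a b a′ b′ → a * b′ ≈ a′ * b → - a * b′ ≈ - a′ * b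
  -‿cong a b a′ b′ e = begin
    - a * b′      ≈⟨ solve 2 (λ a b → :- a :* b := :- (a :* b)) refl a b′ ⟩
    - (a * b′)    ≈⟨ R.-‿cong e ⟩
    - (a′ * b)    ≈⟨ solve 2 (λ a b → :- (a :* b) := :- a :* b) refl a′ b ⟩
    - a′ * b      ∎

  +-assoc : ∀ a b c d e f →
    ((a * d + c * b) * f + e * (b * d)) * (b * (d * f))
      ≈ (a * (d * f) + (c * f + e * d) * b) * (b * d * f)
  +-assoc = solve 6 (λ a b c d e f →
    ((a :* d :+ c :* b) :* f :+ e :* (b :* d)) :* (b :* (d :* f))
      := (a :* (d :* f) :+ (c :* f :+ e :* d) :* b) :* (b :* d :* f)) refl

  +-comm : ∀ a b c d → (a * d + c * b) * (d * b) ≈ (c * b + a * d) * (b * d)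
  +-comm = solve 4 (λ a b c d → (a :* d :+ c :* b) :* (d :* b) := (c :* b :+ a :* d) :* (b :* d)) refl

  +-identityˡ : ∀ a b → (0# * b + a * 1#) * b ≈ a * (1# * b)
  +-identityˡ = solve 2 (λ a b → (con 0ℤ :* b :+ a :* con 1ℤ) :* b := a :* (con 1ℤ :* b)) refl

  +-inverseˡ : ∀ a b → (- a * b + a * b) * 1# ≈ 0# * (b * b)
  +-inverseˡ = solve 2 (λ a b → (:- a :* b :+ a :* b) :* con 1ℤ := con 0ℤ :* (b :* b)) refl

  *-assoc : ∀ a b c d e f → a * c * e * (b * (d * f)) ≈ a * (c * e) * (b * d * f)
  *-assoc = solve 6 (λ a b c d e f →
    a :* c :* e :* (b :* (d :* f)) := a :* (c :* e) :* (b :* d :* f)) refl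

  *-comm : ∀ a b c d → a * c * (d * b) ≈ c * a * (b * d)
  *-comm = solve 4 (λ a b c d → a :* c :* (d :* b) := c :* a :* (b :* d)) refl

  *-identityˡ : ∀ a b → 1# * a * b ≈ a * (1# * b)
  *-identityˡ = solve 2 (λ a b → con 1ℤ :* a :* b := a :* (con 1ℤ :* b)) refl

  *-distribˡ-+ : ∀ a b c d e f →
    a * (c * f + e * d) * (b * d * (b * f)) ≈ (a * c * (b * f) + a * e * (b * d)) * (b * (d * f))
  *-distribˡ-+ = solve 6 (λ a b c d e f →
    a :* (c :* f :+ e :* d) :* (b :* d :* (b :* f))
      := (a :* c :* (b :* f) :+ a :* e :* (b :* d)) :* (b :* (d :* f))) refl

  *-distribʳ-+ : ∀ a b c d e f →
    (c * f + e * d) * a * (d * b * (f * b)) ≈ (c * a * (f * b) + e * a * (d * b)) * (d * f * b)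
  *-distribʳ-+ = solve 6 (λ a b c d e f →
    (c :* f :+ e :* d) :* a :* (d :* b :* (f :* b))
      := (c :* a :* (f :* b) :+ e :* a :* (d :* b)) :* (d :* f :* b)) refl

  *-inverseʳ : ∀ a b → a * b * 1# ≈ 1# * (b * a)
  *-inverseʳ = solve 2 (λ a b → a :* b :* con 1ℤ := con 1ℤ :* (b :* a)) refl

-- The four closed forms over a ring with the required inverses.

module ClosedForms {c ℓ} (R : CommutativeRing c ℓ) where
  open CommutativeRing R hiding (_-_; zero)
  open RingNotions rawRing
  open IntegerSolver R
  open RingLemmas R
  open GaussianBinomials R
  open IntegerPowers R
  open PositivePowers R
  open NegativePowers R
  open Algebra.Properties.Ring ring using (-1*x≈-x)
  open Relation.Binary.Reasoning.Setoid setoid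

  -- One index is split off at each end; the middle range is that of n because (l+1) - (n+1) = l -
  -- n.
  ∑±-suc : ∀ n f → ∑± (suc n) f ≈ f -[1+ n ] + ∑± n f + f (+ suc n)
  ∑±-suc n f = begin
    f -[1+ n ] + ∑[ l < 2 ℕ.* suc n ] f (suc l ℤ.⊖ suc n)
      ≈⟨ +-congˡ (∑-cong (2 ℕ.* suc n) λ l → reflexive (≡.cong f (ℤ.[1+m]⊖[1+n]≡m⊖n l n))) ⟩
    f -[1+ n ] + ∑[ l < 2 ℕ.* suc n ] f (l ℤ.⊖ n)
      ≡⟨ ≡.cong (λ m → f -[1+ n ] + ∑[ l < m ] f (l ℤ.⊖ n)) (ℕ.*-suc 2 n) ⟩
    f -[1+ n ] + ∑[ l < suc (suc (2 ℕ.* n)) ] f (l ℤ.⊖ n)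
      ≈⟨ +-congˡ (∑-last (suc (2 ℕ.* n)) (λ l → f (l ℤ.⊖ n))) ⟩
    f -[1+ n ] + (∑± n f + f (suc (2 ℕ.* n) ℤ.⊖ n))
      ≈⟨ +-assoc _ _ _ ⟨
    f -[1+ n ] + ∑± n f + f (suc (2 ℕ.* n) ℤ.⊖ n)
      ≡⟨ ≡.cong (λ i → f -[1+ n ] + ∑± n f + f i) 1+2n⊖n ⟩
    f -[1+ n ] + ∑± n f + f (+ suc n) ∎
    where
    1+2n≡ : suc (2 ℕ.* n) ≡ suc n ℕ.+ n
    1+2n≡ = ≡.cong (λ m → suc (n ℕ.+ m)) (ℕ.+-identityʳ n)
    1+2n⊖n : suc (2 ℕ.* n) ℤ.⊖ n ≡ + suc n
    1+2n⊖n = ≡.trans (≡.cong (ℤ._⊖ n) 1+2n≡)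
      (≡.trans (ℤ.⊖-≥ (ℕ.m≤n+m n (suc n))) (≡.cong +_ (ℕ.m+n∸n≡m (suc n) n)))

  -- At t = 1 the factor 1 - t² removes the inner sum, and 1 + t = 2 accounts for the two indices j
  -- = k+1 and j = -(k+1).
  T-one : ∀ k q p → T k 1# q ≈ ∑[ j ∈± k ] zpow (- q) p (j ℤ.* j)
  T-one zero    q p = sym (+-identityʳ 1#)
  T-one (suc k) q p = begin
    T k 1# q + (1# + 1#) * x + (1# - 1# ^ 2) * Tsum (suc k) k 1# q
      ≈⟨ solve 3 (λ t x y → t :+ (con 1ℤ :+ con 1ℤ) :* x :+ (con 1ℤ :- con 1ℤ :^ 2) :* y
                         := x :+ t :+ x) refl _ _ _ ⟩
    x + T k 1# q + x
      ≈⟨ +-cong (+-cong x≈ (T-one k q p)) x≈ ⟩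
    x′ + ∑[ j ∈± k ] zpow (- q) p (j ℤ.* j) + x′
      ≈⟨ ∑±-suc k (λ j → zpow (- q) p (j ℤ.* j)) ⟨
    ∑[ j ∈± suc k ] zpow (- q) p (j ℤ.* j) ∎
    where
    x = (- q) ^ (suc k ℕ.^ 2)
    x′ = (- q) ^ (suc k ℕ.* suc k)
    x≈ : x ≈ x′
    x≈ = ^-≡ (- q) (≡.cong (suc k ℕ.*_) (ℕ.*-identityʳ (suc k)))

  -- Both 1 + t and 1 - t² vanish at t = -1, so the recursion is constant.
  T-minusOne : ∀ k q → T k (- 1#) q ≈ 1#
  T-minusOne zero    q = refl
  T-minusOne (suc k) q = trans
    (solve 3 (λ t x y → t :+ (con 1ℤ :+ (:- con 1ℤ)) :* x
                          :+ (con 1ℤ :- (:- con 1ℤ) :^ 2) :* y := t) refl _ _ _)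
    (T-minusOne k q)

  inverse-unique : ∀ {u v w} → u * v ≈ 1# → u * w ≈ 1# → v ≈ w
  inverse-unique {u} {v} {w} uv≈1 uw≈1 = begin
    v            ≈⟨ *-identityʳ v ⟨
    v * 1#       ≈⟨ *-congˡ uw≈1 ⟨
    v * (u * w)  ≈⟨ solve 3 (λ v u w → v :* (u :* w) := u :* v :* w) refl v u w ⟩
    u * v * w    ≈⟨ *-congʳ uv≈1 ⟩
    1# * w       ≈⟨ *-identityˡ w ⟩
    w            ∎

  binomial-quotient : ∀ x {m n} v → m ℕ.≤ n →
    ⟨ x ⨾ x ⟩ m * ⟨ x ⨾ x ⟩ (n ℕ.∸ m) * v ≈ 1# → ⟨ x ⨾ x ⟩ n * v ≈ binomial x n m
  binomial-quotient x {m} {n} v m≤n dv≈1 = begin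
    ⟨ x ⨾ x ⟩ n * v
      ≡⟨ ≡.cong (λ k → ⟨ x ⨾ x ⟩ k * v) (ℕ.m+[n∸m]≡n m≤n) ⟨
    ⟨ x ⨾ x ⟩ (m ℕ.+ (n ℕ.∸ m)) * v
      ≈⟨ *-congʳ (binomial-pochhammer x m (n ℕ.∸ m)) ⟨
    d * binomial x (m ℕ.+ (n ℕ.∸ m)) m * v
      ≈⟨ solve 3 (λ d g v → d :* g :* v := d :* v :* g) refl _ _ _ ⟩
    d * v * binomial x (m ℕ.+ (n ℕ.∸ m)) m
      ≈⟨ *-cong dv≈1 (reflexive (≡.cong (λ k → binomial x k m) (ℕ.m+[n∸m]≡n m≤n))) ⟩
    1# * binomial x n m
      ≈⟨ *-identityˡ _ ⟩
    binomial x n m ∎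
    where d = ⟨ x ⨾ x ⟩ m * ⟨ x ⨾ x ⟩ (n ℕ.∸ m)

  -- The operations on rational functions enter as parameters: equality of
  -- concrete fractions unfolds to an equality of coefficients, from which
  -- implicit arguments cannot be inferred.
  module Evaluations
    (q : Carrier) (inv : Carrier → Carrier) (_^ℤ_ : Carrier → ℤ → Carrier)
    (gauss : Carrier → ℤ → ℤ → Carrier)
    (^ℤ≈zpow : ∀ f i → f ^ℤ i ≈ zpow f (inv f) i)
    (gauss≈binomial : ∀ n m → gauss (q ^ 2) (+ n) (+ m) ≈ binomial (q ^ 2) n m)
    (gauss-[-1,0] : gauss (q ^ 2) -[1+ 0 ] (+ 0) ≈ 1#)
    (q-invertible : q * inv q ≈ 1#)
    (-q-invertible : - q * inv (- q) ≈ 1#)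
    (pochhammer-invertible : ∀ n → ⟨ q ⨾ q ⟩ n * inv (⟨ q ⨾ q ⟩ n) ≈ 1#)
    (pochhammer--invertible : ∀ n → ⟨ - q ⨾ q ⟩ n * inv (⟨ - q ⨾ q ⟩ n) ≈ 1#)
    where

    private
      p = inv q

    open Descent q p q-invertible

    -- The top k+i-1 is negative only for k = i = 0, where the convention [-1 0] = 1 applies; for k
    -- = 0 and i > 0 the top falls short of the bottom by one and both sides are 0.
    gauss≈multichoose : ∀ k i → gauss (q ^ 2) (+ k ℤ.+ + i ℤ.- + 1) (+ i) ≈ multichoose (q ^ 2) k i
    gauss≈multichoose zero    zero    = gauss-[-1,0]
    gauss≈multichoose zero    (suc i) =
      trans (gauss≈binomial i (suc i)) (binomial-zero (q ^ 2) (ℕ.n<1+n i))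
    gauss≈multichoose (suc k) i       = gauss≈binomial (k ℕ.+ i) i

    gauss-tail : ∀ b k i → i ℕ.< b →
      gauss (q ^ 2) (+ b ℤ.- + i ℤ.- + 1) (+ suc k ℤ.- + 1) ≈ binomial (q ^ 2) (b ℕ.∸ i ℕ.∸ 1) k
    gauss-tail b k i i<b with n , ≡.refl ← ℕ.m≤n⇒∃[o]m+o≡n i<b = begin
      gauss (q ^ 2) (+ suc (i ℕ.+ n) ℤ.- + i ℤ.- + 1) (+ k)
        ≡⟨ ≡.cong (λ m → gauss (q ^ 2) m (+ k)) (IntExponents.index (+ i) (+ n)) ⟩
      gauss (q ^ 2) (+ n) (+ k)
        ≈⟨ gauss≈binomial n k ⟩
      binomial (q ^ 2) n k
        ≡⟨ ≡.cong (λ m → binomial (q ^ 2) m k) ([1+m+n]∸m∸1≡n i n) ⟨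
      binomial (q ^ 2) (suc (i ℕ.+ n) ℕ.∸ i ℕ.∸ 1) k ∎

    -- Serves both signs. `head` is left open because T_(k-i)(s) appears as a theta sum for s = 1
    -- and is omitted for s = -1; `a` and `t` stand for s q and s q^b as the final formulas write
    -- them.
    T-positive-quotient : ∀ s a t (head : ℕ → Carrier) b k → s * s ≈ 1# → a ≈ s * q → t ≈ s * q ^ b →
      ⟨ a ⨾ q ⟩ b * inv (⟨ a ⨾ q ⟩ b) ≈ 1# →
      (∀ i → i ℕ.< suc k → head i ≈ q ^ (i ℕ.* (2 ℕ.* suc k ℕ.+ 1)) * inv (⟨ a ⨾ q ⟩ b)
                                  * gauss (q ^ 2) (+ b) (+ i) * T (suc k ℕ.∸ i) s q) →
      T (suc k) t q
        ≈ ∑< (suc k) head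
          + ∑[ i < b ] (⟨ a ⨾ q ⟩ i * inv (⟨ a ⨾ q ⟩ b)
                          * q ^ (suc k ℕ.* (2 ℕ.* suc k ℕ.+ 2 ℕ.* i ℕ.+ 1))
                          * gauss (q ^ 2) (+ b ℤ.- + i ℤ.- + 1) (+ suc k ℤ.- + 1))
    T-positive-quotient s a t head b k s²≈1 a≈ t≈ Pv≈1 head≈ = begin
      T (suc k) t q
        ≈⟨ T-cong (suc k) q t≈ ⟩
      T (suc k) (s * q ^ b) q
        ≈⟨ *-identityˡ _ ⟨
      1# * T (suc k) (s * q ^ b) q
        ≈⟨ *-congʳ (trans (*-comm v _) (trans (*-congʳ (sym (pochhammer-cong q b a≈))) Pv≈1)) ⟨
      v * ⟨ s * q ⨾ q ⟩ b * T (suc k) (s * q ^ b) q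
        ≈⟨ *-assoc _ _ _ ⟩
      v * (⟨ s * q ⨾ q ⟩ b * T (suc k) (s * q ^ b) q)
        ≈⟨ *-congˡ (T-positive s q s²≈1 b (suc k)) ⟩
      v * (headSum⁺ s q b (suc k) + tailSum⁺ s q b (suc k))
        ≈⟨ distribˡ v _ _ ⟩
      v * headSum⁺ s q b (suc k) + v * tailSum⁺ s q b (suc k)
        ≈⟨ +-cong (∑-*ˡ (suc k) v h) (∑-*ˡ b v g) ⟨
      ∑[ i < suc k ] (v * h i) + ∑[ i < b ] (v * g i)
        ≈⟨ +-cong (∑-cong< (suc k) h≈) (∑-cong< b g≈) ⟩
      ∑< (suc k) head + ∑< b tail ∎
      where
      v = inv (⟨ a ⨾ q ⟩ b)
      h g tail : ℕ → Carrier
      h i = q ^ (i ℕ.* (2 ℕ.* suc k ℕ.+ 1)) * binomial (q ^ 2) b i * T (suc k ℕ.∸ i) s q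
      g i = ⟨ s * q ⨾ q ⟩ i * q ^ (suc k ℕ.* (2 ℕ.* suc k ℕ.+ 2 ℕ.* i ℕ.+ 1))
              * binomial (q ^ 2) (b ℕ.∸ i ℕ.∸ 1) k
      tail i = ⟨ a ⨾ q ⟩ i * v * q ^ (suc k ℕ.* (2 ℕ.* suc k ℕ.+ 2 ℕ.* i ℕ.+ 1))
              * gauss (q ^ 2) (+ b ℤ.- + i ℤ.- + 1) (+ suc k ℤ.- + 1)
      h≈ : ∀ i → i ℕ.< suc k → v * h i ≈ head i
      h≈ i i<k = begin
        v * h i
          ≈⟨ solve 4 (λ v x g t → v :* (x :* g :* t) := x :* v :* g :* t) refl _ _ _ _ ⟩
        q ^ (i ℕ.* (2 ℕ.* suc k ℕ.+ 1)) * v * binomial (q ^ 2) b i * T (suc k ℕ.∸ i) s q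
          ≈⟨ *-congʳ (*-congˡ (gauss≈binomial b i)) ⟨
        q ^ (i ℕ.* (2 ℕ.* suc k ℕ.+ 1)) * v * gauss (q ^ 2) (+ b) (+ i) * T (suc k ℕ.∸ i) s q
          ≈⟨ head≈ i i<k ⟨
        head i ∎
      g≈ : ∀ i → i ℕ.< b → v * g i ≈ tail i
      g≈ i i<b = begin
        v * g i
          ≈⟨ solve 4 (λ v x g t → v :* (x :* g :* t) := x :* v :* g :* t) refl _ _ _ _ ⟩
        ⟨ s * q ⨾ q ⟩ i * v * q ^ (suc k ℕ.* (2 ℕ.* suc k ℕ.+ 2 ℕ.* i ℕ.+ 1))
          * binomial (q ^ 2) (b ℕ.∸ i ℕ.∸ 1) k
          ≈⟨ *-cong (*-congʳ (*-congʳ (pochhammer-cong q i a≈))) (gauss-tail b k i i<b) ⟨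
        tail i ∎

    -1²≈1 : - 1# * - 1# ≈ 1#
    -1²≈1 = solve 0 (:- con 1ℤ :* :- con 1ℤ := con 1ℤ) refl

    T-q^b : ∀ b k → 1 ℕ.≤ k → T k (q ^ b) q
      ≈ ∑[ i < k ] (q ^ (i ℕ.* (2 ℕ.* k ℕ.+ 1)) * inv (⟨ q ⨾ q ⟩ b)
                      * gauss (q ^ 2) (+ b) (+ i)
                      * ∑[ j ∈± (k ℕ.∸ i) ] ((- q) ^ℤ (j ℤ.* j)))
        + ∑[ i < b ] (⟨ q ⨾ q ⟩ i * inv (⟨ q ⨾ q ⟩ b)
                        * q ^ (k ℕ.* (2 ℕ.* k ℕ.+ 2 ℕ.* i ℕ.+ 1))
                        * gauss (q ^ 2) (+ b ℤ.- + i ℤ.- + 1) (+ k ℤ.- + 1))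
    T-q^b b (suc k) _ = T-positive-quotient 1# q (q ^ b)
      (λ i → x i * ∑[ j ∈± (suc k ℕ.∸ i) ] ((- q) ^ℤ (j ℤ.* j))) b k (*-identityˡ 1#)
      (sym (*-identityˡ q)) (sym (*-identityˡ (q ^ b))) (pochhammer-invertible b)
      λ i _ → *-congˡ {x i} (sym (theta (suc k ℕ.∸ i)))
      where
      x : ℕ → Carrier
      x i = q ^ (i ℕ.* (2 ℕ.* suc k ℕ.+ 1)) * inv (⟨ q ⨾ q ⟩ b) * gauss (q ^ 2) (+ b) (+ i)
      theta : ∀ m → T m 1# q ≈ ∑[ j ∈± m ] ((- q) ^ℤ (j ℤ.* j))
      theta m = trans (T-one m q (inv (- q)))
        (∑-cong (suc (2 ℕ.* m)) λ l → sym (^ℤ≈zpow (- q) ((l ℤ.⊖ m) ℤ.* (l ℤ.⊖ m))))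

    T--q^b : ∀ b k → 1 ℕ.≤ k → T k (- (q ^ b)) q
      ≈ ∑[ i < k ] (q ^ (i ℕ.* (2 ℕ.* k ℕ.+ 1)) * inv (⟨ - q ⨾ q ⟩ b)
                      * gauss (q ^ 2) (+ b) (+ i))
        + ∑[ i < b ] (⟨ - q ⨾ q ⟩ i * inv (⟨ - q ⨾ q ⟩ b)
                        * q ^ (k ℕ.* (2 ℕ.* k ℕ.+ 2 ℕ.* i ℕ.+ 1))
                        * gauss (q ^ 2) (+ b ℤ.- + i ℤ.- + 1) (+ k ℤ.- + 1))
    T--q^b b (suc k) _ = T-positive-quotient (- 1#) (- q) (- (q ^ b)) x b k -1²≈1
      (sym (-1*x≈-x q)) (sym (-1*x≈-x (q ^ b))) (pochhammer--invertible b)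
      λ i _ → sym (trans (*-congˡ {x i} (T-minusOne (suc k ℕ.∸ i) q)) (*-identityʳ (x i)))
      where
      x : ℕ → Carrier
      x i = q ^ (i ℕ.* (2 ℕ.* suc k ℕ.+ 1)) * inv (⟨ - q ⨾ q ⟩ b) * gauss (q ^ 2) (+ b) (+ i)

    [-q]^ℤ : ∀ i → (- q) ^ℤ i ≈ Q i
    [-q]^ℤ i = trans (^ℤ≈zpow (- q) i)
      -- `Q` uses -p for the inverse of -q, whereas `_^ℤ_` uses `inv (- q)`; inverses are unique.
      (zpow-cong refl (inverse-unique -q-invertible -q*-p≈1) i)

    base≈ : ∀ s b → base s b ≈ s * (q ^ℤ (+ 1 ℤ.- + b))
    base≈ s b = *-congˡ (sym (begin
      q ^ℤ (+ 1 ℤ.- + b)                 ≈⟨ ^ℤ≈zpow q _ ⟩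
      zpow q p (+ 1 ℤ.- + b)             ≈⟨ zpow-+ q-invertible (+ 1) (ℤ.- + b) ⟩
      q * 1# * zpow q p (ℤ.- + b)        ≈⟨ *-congˡ (zpow-neg q p b) ⟩
      q * 1# * p ^ b                     ≈⟨ solve 2 (λ q x → q :* con 1ℤ :* x := x :* q) refl _ _ ⟩
      p ^ b * q                          ∎))

    q^ℤ- : ∀ s b → s * (q ^ℤ (ℤ.- + b)) ≈ s * p ^ b
    q^ℤ- s b = *-congˡ (trans (^ℤ≈zpow q (ℤ.- + b)) (zpow-neg q p b))

    T-q^-b : ∀ b k → 1 ℕ.≤ b → T k (q ^ℤ (ℤ.- + b)) q
      ≈ ∑[ i < b ] (⟨ q ^ℤ (+ 1 ℤ.- + b) ⨾ q ⟩ i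
                      * (- q) ^ℤ (+ k ℤ.* (+ k ℤ.- + 2 ℤ.* + b ℤ.+ + 2) ℤ.+ + 2 ℤ.* + i)
                      * gauss (q ^ 2) (+ k ℤ.+ + i ℤ.- + 1) (+ i))
    T-q^-b b k 1≤b = begin
      T k (q ^ℤ (ℤ.- + b)) q
        ≈⟨ T-cong k q (trans (sym (*-identityˡ _)) (q^ℤ- 1# b)) ⟩
      T k (1# * p ^ b) q
        ≈⟨ T-negative 1²≈1 b k (inj₁ 1≤b) ⟩
      ⟨ a ⨾ q ⟩ b * headSum⁻ 1# b k + Q (d b k) * tailSum⁻ 1# b k
        ≈⟨ +-congʳ (trans (*-congʳ (vanishes b 1≤b)) (zeroˡ _)) ⟩
      0# + Q (d b k) * tailSum⁻ 1# b k
        ≈⟨ +-identityˡ _ ⟩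
      Q (d b k) * tailSum⁻ 1# b k
        ≈⟨ ∑-*ˡ b (Q (d b k)) f ⟨
      ∑[ i < b ] (Q (d b k) * f i)
        ≈⟨ ∑-cong b f≈ ⟩
      ∑< b g ∎
      where
      1²≈1 = *-identityˡ 1#
      a = base 1# b
      d : ℕ → ℕ → ℤ
      d b k = + k ℤ.* (+ k ℤ.- + 2 ℤ.* + b ℤ.+ + 2)
      f g : ℕ → Carrier
      f i = ⟨ a ⨾ q ⟩ i * q ^ (2 ℕ.* i) * multichoose (q ^ 2) k i
      g i = ⟨ q ^ℤ (+ 1 ℤ.- + b) ⨾ q ⟩ i * (- q) ^ℤ (d b k ℤ.+ + 2 ℤ.* + i)
              * gauss (q ^ 2) (+ k ℤ.+ + i ℤ.- + 1) (+ i)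
      -- The last of the b factors is 1 - q^(1-b) q^(b-1) = 0.
      vanishes : ∀ b → 1 ℕ.≤ b → ⟨ base 1# b ⨾ q ⟩ b ≈ 0#
      vanishes (suc b) _ = begin
        ⟨ a′ ⨾ q ⟩ (suc b)
          ≈⟨ pochhammer-last a′ q b ⟩
        ⟨ a′ ⨾ q ⟩ b * (1# - 1# * (p * p ^ b * q) * q ^ b)
          ≈⟨ solve 5 (λ P p q x y → P :* (con 1ℤ :- con 1ℤ :* (p :* x :* q) :* y)
                 := P :* (con 1ℤ :- q :* p :* (y :* x))) refl _ _ _ _ _ ⟩
        ⟨ a′ ⨾ q ⟩ b * (1# - q * p * (q ^ b * p ^ b))
          ≈⟨ *-congˡ (+-congˡ (-‿cong (*-cong q-invertible (^-inverse q-invertible b)))) ⟩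
        ⟨ a′ ⨾ q ⟩ b * (1# - 1# * 1#)
          ≈⟨ solve 1 (λ P → P :* (con 1ℤ :- con 1ℤ :* con 1ℤ) := con 0ℤ) refl _ ⟩
        0# ∎
        where a′ = base 1# (suc b)
      f≈ : ∀ i → Q (d b k) * f i ≈ g i
      f≈ i = begin
        Q (d b k) * f i
          ≈⟨ solve 4 (λ x P y m → x :* (P :* y :* m) := P :* (x :* y) :* m) refl _ _ _ _ ⟩
        ⟨ a ⨾ q ⟩ i * (Q (d b k) * q ^ (2 ℕ.* i)) * multichoose (q ^ 2) k i
          ≈⟨ *-cong (*-cong (pochhammer-cong q i (trans (base≈ 1# b) (*-identityˡ _))) [-q]^)
                    (sym (gauss≈multichoose k i)) ⟩
        g i ∎
        where
        [-q]^ : Q (d b k) * q ^ (2 ℕ.* i) ≈ (- q) ^ℤ (d b k ℤ.+ + 2 ℤ.* + i)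
        [-q]^ = begin
          Q (d b k) * q ^ (2 ℕ.* i)          ≈⟨ *-congˡ (q^2* i) ⟩
          Q (d b k) * Q (+ 2 ℤ.* + i)        ≈⟨ Q-split (d b k) (+ 2 ℤ.* + i) ≡.refl ⟨
          Q (d b k ℤ.+ + 2 ℤ.* + i)          ≈⟨ [-q]^ℤ _ ⟨
          (- q) ^ℤ (d b k ℤ.+ + 2 ℤ.* + i)   ∎

    T--q^-b : ∀ b k → 1 ℕ.≤ b → T k (- (q ^ℤ (ℤ.- + b))) q
      ≈ ∑[ i < k ] (⟨ - (q ^ℤ (+ 1 ℤ.- + b)) ⨾ q ⟩ b
                      * (- q) ^ℤ (+ i ℤ.* (+ 2 ℤ.* + k ℤ.- + 2 ℤ.* + b ℤ.- + i ℤ.+ + 2))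
                      * gauss (q ^ 2) (+ b ℤ.+ + i ℤ.- + 1) (+ i))
        + (- q) ^ℤ (+ k ℤ.* + k ℤ.+ + 2 ℤ.* + k ℤ.- + 2 ℤ.* + k ℤ.* + b)
          * ∑[ i < b ] (⟨ - (q ^ℤ (+ 1 ℤ.- + b)) ⨾ q ⟩ i
                          * q ^ (2 ℕ.* i)
                          * gauss (q ^ 2) (+ k ℤ.+ + i ℤ.- + 1) (+ i))
    T--q^-b b k 1≤b = begin
      T k (- (q ^ℤ (ℤ.- + b))) q
        ≈⟨ T-cong k q (trans (sym (-1*x≈-x _)) (q^ℤ- (- 1#) b)) ⟩
      T k (- 1# * p ^ b) q
        ≈⟨ T-negative -1²≈1 b k (inj₁ 1≤b) ⟩
      ⟨ a ⨾ q ⟩ b * ∑< k h + Q d * ∑< b f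
        ≈⟨ +-congʳ (∑-*ˡ k (⟨ a ⨾ q ⟩ b) h) ⟨
      ∑[ i < k ] (⟨ a ⨾ q ⟩ b * h i) + Q d * ∑< b f
        ≈⟨ +-cong (∑-cong k h≈) (*-cong Q-d (∑-cong b f≈)) ⟩
      ∑< k h′ + (- q) ^ℤ (+ k ℤ.* + k ℤ.+ + 2 ℤ.* + k ℤ.- + 2 ℤ.* + k ℤ.* + b) * ∑< b f′ ∎
      where
      a = base (- 1#) b
      d : ℤ
      d = + k ℤ.* (+ k ℤ.- + 2 ℤ.* + b ℤ.+ + 2)
      e : ℕ → ℤ
      e i = + i ℤ.* (+ 2 ℤ.* + k ℤ.- + 2 ℤ.* + b ℤ.- + i ℤ.+ + 2)
      h h′ f f′ : ℕ → Carrier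
      h i = Q (e i) * multichoose (q ^ 2) b i * T (k ℕ.∸ i) (- 1#) q
      h′ i = ⟨ - (q ^ℤ (+ 1 ℤ.- + b)) ⨾ q ⟩ b * (- q) ^ℤ e i
               * gauss (q ^ 2) (+ b ℤ.+ + i ℤ.- + 1) (+ i)
      f i = ⟨ a ⨾ q ⟩ i * q ^ (2 ℕ.* i) * multichoose (q ^ 2) k i
      f′ i = ⟨ - (q ^ℤ (+ 1 ℤ.- + b)) ⨾ q ⟩ i * q ^ (2 ℕ.* i)
               * gauss (q ^ 2) (+ k ℤ.+ + i ℤ.- + 1) (+ i)
      a≈ : a ≈ - (q ^ℤ (+ 1 ℤ.- + b))
      a≈ = trans (base≈ (- 1#) b) (-1*x≈-x _)
      f≈ : ∀ i → f i ≈ f′ i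
      f≈ i = *-cong (*-congʳ (pochhammer-cong q i a≈)) (sym (gauss≈multichoose k i))
      h≈ : ∀ i → ⟨ a ⨾ q ⟩ b * h i ≈ h′ i
      h≈ i = begin
        ⟨ a ⨾ q ⟩ b * h i
          ≈⟨ *-congˡ (trans (*-congˡ (T-minusOne (k ℕ.∸ i) q)) (*-identityʳ _)) ⟩
        ⟨ a ⨾ q ⟩ b * (Q (e i) * multichoose (q ^ 2) b i)
          ≈⟨ *-assoc _ _ _ ⟨
        ⟨ a ⨾ q ⟩ b * Q (e i) * multichoose (q ^ 2) b i
          ≈⟨ *-cong (*-cong (pochhammer-cong q b a≈) (sym ([-q]^ℤ (e i))))
                    (sym (gauss≈multichoose b i)) ⟩
        h′ i ∎
      Q-d : Q d ≈ (- q) ^ℤ (+ k ℤ.* + k ℤ.+ + 2 ℤ.* + k ℤ.- + 2 ℤ.* + k ℤ.* + b)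
      Q-d = trans
        (reflexive (≡.cong Q (IntExponents.tail-expand (+ k) (+ b))))
        (sym ([-q]^ℤ _))

-- The rational functions as a ring, and invertible denominators.

module RationalFunctions where
  open Defs
  open RatFun
  open Polynomials using (polyRing; coeff--ₚ)
  private
    module F = FractionIdentities polyRing
    module R = RawRing ratFunRawRing

  -- If p - r had a nonzero coefficient, so would (p - r) s by `*ₚ-nonZero`. Being nonzero is
  -- decidable, so this proves equality.
  *ₚ-cancelʳ : ∀ p r s → NonZeroₚ s → p *ₚ s ≈ₚ r *ₚ s → p ≈ₚ r
  *ₚ-cancelʳ p r s s≢0 ps≈rs with nonZeroₚ? (p +ₚ -ₚ r)
  ... | yes p-r≢0 with n , c≢0 ← *ₚ-nonZero (p +ₚ -ₚ r) s p-r≢0 s≢0 =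
    contradiction (F.difference-0 p r s ps≈rs n) c≢0
  ... | no p-r≡0 = F.from-difference-0 p r zeros
    where
    zeros : p +ₚ -ₚ r ≈ₚ 0ₚ
    zeros n with coeff (p +ₚ -ₚ r) n ℤ.≟ 0ℤ
    ... | yes c≡0 = c≡0
    ... | no c≢0  = contradiction (n , c≢0) p-r≡0

  ratFun-isCommutativeRing : IsCommutativeRing R._≈_ R._+_ R._*_ R.-_ R.0# R.1#
  ratFun-isCommutativeRing = record
    { isRing = record
      { +-isAbelianGroup = record
        { isGroup = record
          { isMonoid = record
            { isSemigroup = record
              { isMagma = record
                { isEquivalence = record
                  { refl  = λ n → ≡.refl
                  ; sym   = λ e n → ≡.sym (e n)
                  ; trans = λ {f} {g} {h} → ≈-trans f g h
                  }
                ; ∙-cong = λ {f} {f′} {g} {g′} → F.+-cong (num f) (den f) (num f′) (den f′)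
                                                   (num g) (den g) (num g′) (den g′)
                }
              ; assoc = λ f g h → F.+-assoc (num f) (den f) (num g) (den g) (num h) (den h)
              }
            ; identity = +-identityˡ , λ f →
                ≈-trans (f R.+ R.0#) (R.0# R.+ f) f (+-comm f R.0#) (+-identityˡ f)
            }
          ; inverse = +-inverseˡ , λ f →
              ≈-trans (f R.+ R.- f) (R.- f R.+ f) R.0# (+-comm f (R.- f)) (+-inverseˡ f)
          ; ⁻¹-cong = λ {f} {g} → F.-‿cong (num f) (den f) (num g) (den g)
          }
        ; comm = +-comm
        }
      ; *-cong = λ {f} {f′} {g} {g′} → F.*-cong (num f) (den f) (num f′) (den f′)
                                         (num g) (den g) (num g′) (den g′)
      ; *-assoc = λ f g h → F.*-assoc (num f) (den f) (num g) (den g) (num h) (den h)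
      ; *-identity = *-identityˡ , λ f →
          ≈-trans (f R.* R.1#) (R.1# R.* f) f (*-comm f R.1#) (*-identityˡ f)
      ; distrib = (λ f g h → F.*-distribˡ-+ (num f) (den f) (num g) (den g) (num h) (den h))
                , (λ f g h → F.*-distribʳ-+ (num f) (den f) (num g) (den g) (num h) (den h))
      }
    ; *-comm = *-comm
    }
    where
    ≈-trans : ∀ f g h → f R.≈ g → g R.≈ h → f R.≈ h
    ≈-trans f g h f≈g g≈h =
      *ₚ-cancelʳ (num f *ₚ den h) (num h *ₚ den f) (den g) (den≢0 g)
        (F.cross-trans (num f) (den f) (num g) (den g) (num h) (den h) f≈g g≈h)
    +-comm : ∀ f g → (f R.+ g) R.≈ (g R.+ f)
    +-comm f g = F.+-comm (num f) (den f) (num g) (den g)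
    *-comm : ∀ f g → (f R.* g) R.≈ (g R.* f)
    *-comm f g = F.*-comm (num f) (den f) (num g) (den g)
    +-identityˡ : ∀ f → (R.0# R.+ f) R.≈ f
    +-identityˡ f = F.+-identityˡ (num f) (den f)
    +-inverseˡ : ∀ f → (R.- f R.+ f) R.≈ R.0#
    +-inverseˡ f = F.+-inverseˡ (num f) (den f)
    *-identityˡ : ∀ f → (R.1# R.* f) R.≈ f
    *-identityˡ f = F.*-identityˡ (num f) (den f)

  ratFunRing : CommutativeRing 0ℓ 0ℓ
  ratFunRing = record { isCommutativeRing = ratFun-isCommutativeRing }

  *-⁻¹ : ∀ f → NonZeroₚ (num f) → f * f ⁻¹ ≈ 1#
  *-⁻¹ f num≢0 with nonZeroₚ? (num f)
  ... | yes _     = F.*-inverseʳ (num f) (den f)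
  ... | no num≡0 = contradiction num≢0 num≡0

  -- f is regular at q = 0 with value a there.  A rational function with value 1
  -- at 0 is not zero, which gives the invertibility of the q-factorials.
  record ValueAt0 (f : RatFun) (a : ℤ) : Set where
    constructor value
    field
      den₀ : coeff (den f) 0 ≡ 1ℤ
      num₀ : coeff (num f) 0 ≡ a

  coeff₀-* : ∀ p r → coeff (p *ₚ r) 0 ≡ coeff p 0 ℤ.* coeff r 0
  coeff₀-* []      r = ≡.refl
  coeff₀-* (a ∷ p) r = ≡.trans (coeff-*ₚ a p r 0) (ℤ.+-identityʳ _)

  value-* : ∀ {f g a b} → ValueAt0 f a → ValueAt0 g b → ValueAt0 (f * g) (a ℤ.* b)
  value-* {f} {g} (value df nf) (value dg ng) = value
    (≡.trans (coeff₀-* (den f) (den g)) (≡.cong₂ ℤ._*_ df dg))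
    (≡.trans (coeff₀-* (num f) (num g)) (≡.cong₂ ℤ._*_ nf ng))

  value-neg : ∀ {f a} → ValueAt0 f a → ValueAt0 (- f) (ℤ.- a)
  value-neg {f} (value df nf) = value df (≡.trans (coeff--ₚ (num f) 0) (≡.cong ℤ.-_ nf))

  value-+ : ∀ {f g a b} → ValueAt0 f a → ValueAt0 g b → ValueAt0 (f + g) (a ℤ.+ b)
  value-+ {f} {g} {a} {b} (value df nf) (value dg ng) = value
    (≡.trans (coeff₀-* (den f) (den g)) (≡.cong₂ ℤ._*_ df dg))
    (≡.trans (coeff-+ₚ (num f *ₚ den g) (num g *ₚ den f) 0) (≡.cong₂ ℤ._+_
      (≡.trans (coeff₀-* (num f) (den g)) (≡.trans (≡.cong₂ ℤ._*_ nf dg) (ℤ.*-identityʳ a)))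
      (≡.trans (coeff₀-* (num g) (den f)) (≡.trans (≡.cong₂ ℤ._*_ ng df) (ℤ.*-identityʳ b)))))

  value-^ : ∀ {f a} n → ValueAt0 f a → ValueAt0 (f ^ n) (a ℤ.^ n)
  value-^ zero    f₀ = value ≡.refl ≡.refl
  value-^ (suc n) f₀ = value-* f₀ (value-^ n f₀)

  -- As a vanishes at q = 0, every factor 1 - a x^l takes the value 1 there.
  value-pochhammer : ∀ {a x v} n → ValueAt0 a 0ℤ → ValueAt0 x v → ValueAt0 (⟨ a ⨾ x ⟩ n) 1ℤ
  value-pochhammer {a} {x} n a₀ x₀ = go n (λ l → l)
    where
    go : ∀ n e → ValueAt0 (product {n} λ l → 1# - a * x ^ e (toℕ l)) 1ℤ
    go zero    e = value ≡.refl ≡.refl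
    go (suc n) e = value-*
      (value-+ {1#} (value ≡.refl ≡.refl) (value-neg (value-* a₀ (value-^ (e 0) x₀))))
      (go n (λ l → e (suc l)))

  value⇒nonZero : ∀ {f} → ValueAt0 f 1ℤ → NonZeroₚ (num f)
  value⇒nonZero (value _ n) = 0 , λ e → contradiction (≡.trans (≡.sym n) e) λ ()

  value-q : ValueAt0 q 0ℤ
  value-q = value ≡.refl ≡.refl

  pochhammer-invertible : ∀ n → ⟨ q ⨾ q ⟩ n * ⟨ q ⨾ q ⟩ n ⁻¹ ≈ 1#
  pochhammer-invertible n = *-⁻¹ (⟨ q ⨾ q ⟩ n) (value⇒nonZero (value-pochhammer n value-q value-q))

  pochhammer--invertible : ∀ n → ⟨ - q ⨾ q ⟩ n * ⟨ - q ⨾ q ⟩ n ⁻¹ ≈ 1#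
  pochhammer--invertible n = *-⁻¹ (⟨ - q ⨾ q ⟩ n)
    (value⇒nonZero (value-pochhammer n (value-neg value-q) value-q))

  open CommutativeRing ratFunRing using (sym; refl)
  open GaussianBinomials ratFunRing using (binomial; binomial-zero)
  open ClosedForms ratFunRing using (binomial-quotient)
  open IntegerPowers ratFunRing using (zpow)

  gauss≈binomial : ∀ n m → gauss (q ^ 2) (+ n) (+ m) ≈ binomial (q ^ 2) n m
  gauss≈binomial n m with m ℕ.≤? n
  ... | yes m≤n = binomial-quotient (q ^ 2) (d ⁻¹) m≤n
    (*-⁻¹ d (value⇒nonZero (value-* (value₁ m) (value₁ (n ℕ.∸ m)))))
    where
    d = ⟨ q ^ 2 ⨾ q ^ 2 ⟩ m * ⟨ q ^ 2 ⨾ q ^ 2 ⟩ (n ℕ.∸ m)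
    value₁ : ∀ n → ValueAt0 (⟨ q ^ 2 ⨾ q ^ 2 ⟩ n) 1ℤ
    value₁ n = value-pochhammer n (value-^ 2 value-q) (value-^ 2 value-q)
  ... | no m≰n  = sym {binomial (q ^ 2) n m} {0#} (binomial-zero (q ^ 2) (ℕ.≰⇒> m≰n))

  ^ℤ≈zpow : ∀ f i → f ^ℤ i ≈ zpow f (f ⁻¹) i
  ^ℤ≈zpow f (+ n)    = refl {f ^ n}
  ^ℤ≈zpow f -[1+ n ] = refl {(f ⁻¹) ^ suc n}

open Defs
open import Data.Product.Base using (_×_)

theorem1p3 :
    ((b k : ℕ) → 1 ℕ.≤ k →
      (T k (q ^ b) q
        ≈ ∑[ i < k ] (q ^ (i ℕ.* (2 ℕ.* k ℕ.+ 1)) / ⟨ q ⨾ q ⟩ b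
                        * gauss (q ^ 2) (+ b) (+ i)
                        * ∑[ j ∈± (k ℕ.∸ i) ] ((- q) ^ℤ (j ℤ.* j)))
          + ∑[ i < b ] (⟨ q ⨾ q ⟩ i / ⟨ q ⨾ q ⟩ b
                          * q ^ (k ℕ.* (2 ℕ.* k ℕ.+ 2 ℕ.* i ℕ.+ 1))
                          * gauss (q ^ 2) (+ b ℤ.- + i ℤ.- + 1) (+ k ℤ.- + 1)))
      ×
      (T k (- (q ^ b)) q
        ≈ ∑[ i < k ] (q ^ (i ℕ.* (2 ℕ.* k ℕ.+ 1)) / ⟨ - q ⨾ q ⟩ b
                        * gauss (q ^ 2) (+ b) (+ i))
          + ∑[ i < b ] (⟨ - q ⨾ q ⟩ i / ⟨ - q ⨾ q ⟩ b
                          * q ^ (k ℕ.* (2 ℕ.* k ℕ.+ 2 ℕ.* i ℕ.+ 1))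
                          * gauss (q ^ 2) (+ b ℤ.- + i ℤ.- + 1) (+ k ℤ.- + 1))))
    ×
    ((b k : ℕ) → 1 ℕ.≤ b →
      (T k (q ^ℤ (ℤ.- + b)) q
        ≈ ∑[ i < b ] (⟨ q ^ℤ (+ 1 ℤ.- + b) ⨾ q ⟩ i
                        * (- q) ^ℤ (+ k ℤ.* (+ k ℤ.- + 2 ℤ.* + b ℤ.+ + 2) ℤ.+ + 2 ℤ.* + i)
                        * gauss (q ^ 2) (+ k ℤ.+ + i ℤ.- + 1) (+ i)))
      ×
      (T k (- (q ^ℤ (ℤ.- + b))) q
        ≈ ∑[ i < k ] (⟨ - (q ^ℤ (+ 1 ℤ.- + b)) ⨾ q ⟩ b
                        * (- q) ^ℤ (+ i ℤ.* (+ 2 ℤ.* + k ℤ.- + 2 ℤ.* + b ℤ.- + i ℤ.+ + 2))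
                        * gauss (q ^ 2) (+ b ℤ.+ + i ℤ.- + 1) (+ i))
          + (- q) ^ℤ (+ k ℤ.* + k ℤ.+ + 2 ℤ.* + k ℤ.- + 2 ℤ.* + k ℤ.* + b)
            * ∑[ i < b ] (⟨ - (q ^ℤ (+ 1 ℤ.- + b)) ⨾ q ⟩ i
                            * q ^ (2 ℕ.* i)
                            * gauss (q ^ 2) (+ k ℤ.+ + i ℤ.- + 1) (+ i))))
theorem1p3 =
    (λ b k 1≤k → F.T-q^b b k 1≤k , F.T--q^b b k 1≤k)
  , (λ b k 1≤b → F.T-q^-b b k 1≤b , F.T--q^-b b k 1≤b)
  where
  open RationalFunctions
  module F = ClosedForms.Evaluations ratFunRing q _⁻¹ _^ℤ_ gauss ^ℤ≈zpow gauss≈binomial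
    (λ n → ≡.refl)
    -- The coefficient in degree 1 shows that q, and on the next line -q, is nonzero.
    (*-⁻¹ q (1 , λ ()))
    (*-⁻¹ (- q) (1 , λ ()))
    pochhammer-invertible pochhammer--invertible
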